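{- For any convex polytope $P$, the moment-angle complex $\mathcal{Z}_{K_P}$ is homotopy equivalent to the moment-angle space $\mathcal{Z}_P$: $$\mathcal{Z}_{K_P}\simeq \mathcal{Z}_P.$$
   Context: Let $P=\{x\in\mathbb{R}^n\mid \langle a_i,x\rangle+b_i\geqslant 0,\ i=1,\dots,m\}$ be a (bounded) $n$-dimensional convex polytope, not necessarily simple, whose facets are exactly the $m$ distinct sets $\mathcal{F}_i=\{x\in P\mid\langle a_i,x\rangle+b_i=0\}$, $i=1,\dots,m$. Write $[m]=\{1,\dots,m\}$. The simplicial complex $K_P$ has vertex set $[m]$; a subset $\{i_1,\dots,i_k\}\subseteq[m]$ is a simplex of $K_P$ iff $\mathcal{F}_{i_1}\cap\dots\cap\mathcal{F}_{i_k}\neq\varnothing$ (the empty set is also a simplex). Moment-angle space of $P$: let $\mathbb{R}^m_{\geqslant}$ be the nonnegative orthant, let $j_P\colon P\to\mathbb{R}^m_{\geqslant}$, $j_P(x)=(\langle a_1,x\rangle+b_1,\dots,\langle a_m,x\rangle+b_m)$, and $p\colon\mathbb{C}^m\to\mathbb{R}^m_{\geqslant}$, $p(z_1,\dots,z_m)=(|z_1|^2,\dots,|z_m|^2)$. Then $\mathcal{Z}_P$ is the pullback of $j_P$ and $p$, i.e. $\mathcal{Z}_P\cong p^{ -1}(j_P(P))\subset\mathbb{C}^m$. Moment-angle complex of a simplicial complex $K\subseteq 2^{[m]}$: with $D^2\subset\mathbb{C}$ the closed unit disk and $S^1=\partial D^2$, $$\mathcal{Z}_K=(D^2,S^1)^K=\bigcup_{\alpha\in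 K}(D^2)^{\alpha}\times (S^1)^{[m]\setminus\alpha}\subseteq (D^2)^m,$$ where $(D^2)^{\alpha}\times (S^1)^{[m]\setminus\alpha}$ is the set of $(z_1,\dots,z_m)$ with $z_i\in D^2$ for $i\in\alpha$ and $z_i\in S^1$ for $i\notin\alpha$. -}

module Defs where

open import Level using (0ℓ)
open import Algebra.Bundles using (CommutativeRing)
import Algebra.Construct.NaturalChoice.Max as Max
import Algebra.Properties.AbelianGroup as AbelianGroupProperties
import Algebra.Properties.CommutativeMonoid.Sum as Sum
import Algebra.Properties.Ring as RingProperties
open import Data.Fin.Base using (Fin; zero; suc)
open import Data.Fin.Subset using (Subset; Empty; _⊆_) renaming (_∈_ to _∈ₛ_; _∉_ to _∉ₛ_; ⊥ to ∅ₛ)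
open import Data.Fin.Subset.Properties using (∉⊥)
open import Data.Nat.Base using (ℕ; suc)
open import Data.Product.Base using (Σ; ∃; ∃₂; ∃-syntax; _×_; _,_; proj₁; proj₂)
open import Data.Sum.Base using (_⊎_; inj₁; inj₂)
open import Data.Vec.Functional using (Vector; foldr)
open import Function.Base using (_on_)
open import Function.Metric.Definitions using (Bounded)
open import Function.Metric.Structures using (IsGeneralMetric; module IsGeneralMetric)
open import Relation.Binary.Bundles using (TotalOrder)
open import Relation.Binary.Core using (Rel)
import Relation.Binary.Construct.NonStrictToStrict as NonStrictToStrict
open import Relation.Binary.PropositionalEquality.Core using (_≡_)
open import Relation.Binary.Structures using (IsTotalOrder; IsEquivalence)
open import Relation.Nullary.Negation using (¬_)
open import Relation.Unary using (Pred; Satisfiable; _∈_; _≐_)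

-- The real numbers: a Dedekind-complete ordered field, which is unique
-- up to unique isomorphism.

record CompleteOrderedField : Set₁ where
  field
    commutativeRing : CommutativeRing 0ℓ 0ℓ

  open CommutativeRing commutativeRing public

  infix 4 _≤_ _<_
  field
    _≤_          : Rel Carrier 0ℓ
    isTotalOrder : IsTotalOrder _≈_ _≤_
    1≉0          : 1# ≉ 0#
    inverse      : ∀ x → x ≉ 0# → ∃[ y ] x * y ≈ 1#
    +-monoˡ-≤    : ∀ z {x y} → x ≤ y → x + z ≤ y + z
    *-nonneg     : ∀ {x y} → 0# ≤ x → 0# ≤ y → 0# ≤ x * y

  UpperBound : Pred Carrier 0ℓ → Pred Carrier 0ℓ
  UpperBound S u = ∀ {x} → x ∈ S → x ≤ u

  field
    supremum : (S : Pred Carrier 0ℓ) → Satisfiable S → Satisfiable (UpperBound S) →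
               ∃[ s ] UpperBound S s × (∀ {u} → UpperBound S u → s ≤ u)

  totalOrder : TotalOrder 0ℓ 0ℓ 0ℓ
  totalOrder = record { isTotalOrder = isTotalOrder }

  open IsTotalOrder isTotalOrder public
    using (isPartialOrder; total; antisym; ≤-respˡ-≈; ≤-respʳ-≈)
    renaming (refl to ≤-refl; reflexive to ≤-reflexive; trans to ≤-trans)

  _<_ : Rel Carrier 0ℓ
  _<_ = NonStrictToStrict._<_ _≈_ _≤_

  open Max totalOrder public using (_⊔_)

  ∣_∣ : Carrier → Carrier
  ∣ x ∣ = x ⊔ (- x)

module OverReals (𝐑 : CompleteOrderedField) where

  open CompleteOrderedField 𝐑 public renaming (Carrier to ℝ; zero to *-zero)
  open RingProperties ring using (-0#≈0#; -‿involutive; -‿distribˡ-*; -‿distribʳ-*)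
  open AbelianGroupProperties +-abelianGroup using (⁻¹-∙-comm)
  open Max totalOrder
    using (⊔-cong; ⊔-comm; ⊔-idem; ⊔-lub; x≤x⊔y; x≤y⊔x; ⊔-mono-≤)
  open Sum +-commutativeMonoid public using (sum; sum-syntax)

  +-mono-≤ : ∀ {w x y z} → w ≤ x → y ≤ z → w + y ≤ x + z
  +-mono-≤ {w} {x} {y} {z} w≤x y≤z = ≤-trans (+-monoˡ-≤ y w≤x)
    (≤-respˡ-≈ (+-comm y x) (≤-respʳ-≈ (+-comm z x) (+-monoˡ-≤ x y≤z)))

  x≤0⇒0≤-x : ∀ {x} → x ≤ 0# → 0# ≤ - x
  x≤0⇒0≤-x {x} x≤0 =
    ≤-respˡ-≈ (-‿inverseʳ x) (≤-respʳ-≈ (+-identityˡ (- x)) (+-monoˡ-≤ (- x) x≤0))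

  -x≤0⇒0≤x : ∀ {x} → - x ≤ 0# → 0# ≤ x
  -x≤0⇒0≤x {x} p = ≤-respʳ-≈ (-‿involutive x) (x≤0⇒0≤-x p)

  0≤x² : ∀ x → 0# ≤ x * x
  0≤x² x with total 0# x
  ... | inj₁ 0≤x = *-nonneg 0≤x 0≤x
  ... | inj₂ x≤0 = ≤-respʳ-≈
    (trans (sym (-‿distribˡ-* x (- x)))
      (trans (-‿cong (sym (-‿distribʳ-* x x))) (-‿involutive (x * x))))
    (*-nonneg (x≤0⇒0≤-x x≤0) (x≤0⇒0≤-x x≤0))

  0≤1 : 0# ≤ 1#
  0≤1 = ≤-respʳ-≈ (*-identityˡ 1#) (0≤x² 1#)

  0≤∣x∣ : ∀ x → 0# ≤ ∣ x ∣
  0≤∣x∣ x with total 0# x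
  ... | inj₁ 0≤x = ≤-trans 0≤x (x≤x⊔y x (- x))
  ... | inj₂ x≤0 = ≤-trans (x≤0⇒0≤-x x≤0) (x≤y⊔x x (- x))

  ∣∣-cong : ∀ {x y} → x ≈ y → ∣ x ∣ ≈ ∣ y ∣
  ∣∣-cong x≈y = ⊔-cong x≈y (-‿cong x≈y)

  ∣-x∣≈∣x∣ : ∀ x → ∣ - x ∣ ≈ ∣ x ∣
  ∣-x∣≈∣x∣ x = trans (⊔-cong refl (-‿involutive x)) (⊔-comm (- x) x)

  ∣0∣≈0 : ∣ 0# ∣ ≈ 0#
  ∣0∣≈0 = trans (⊔-cong refl -0#≈0#) (⊔-idem 0#)

  ∣x∣≈0⇒x≈0 : ∀ {x} → ∣ x ∣ ≈ 0# → x ≈ 0#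
  ∣x∣≈0⇒x≈0 {x} p = antisym (≤-respʳ-≈ p (x≤x⊔y x (- x)))
                            (-x≤0⇒0≤x (≤-respʳ-≈ p (x≤y⊔x x (- x))))

  ∣x+y∣≤∣x∣+∣y∣ : ∀ x y → ∣ x + y ∣ ≤ ∣ x ∣ + ∣ y ∣
  ∣x+y∣≤∣x∣+∣y∣ x y = ⊔-lub
    (+-mono-≤ (x≤x⊔y x (- x)) (x≤x⊔y y (- y)))
    (≤-respˡ-≈ (⁻¹-∙-comm x y) (+-mono-≤ (x≤y⊔x x (- x)) (x≤y⊔x y (- y))))

  max : ∀ {n} → Vector ℝ n → ℝ
  max = foldr _⊔_ 0#

  0≤max : ∀ {n} (u : Vector ℝ n) → 0# ≤ max u
  0≤max {0}     u = ≤-refl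
  0≤max {suc n} u = ≤-trans (0≤max (λ i → u (suc i))) (x≤y⊔x (u zero) _)

  u≤max : ∀ {n} (u : Vector ℝ n) i → u i ≤ max u
  u≤max u zero    = x≤x⊔y (u zero) _
  u≤max u (suc i) = ≤-trans (u≤max (λ j → u (suc j)) i) (x≤y⊔x (u zero) _)

  max-least : ∀ {n} (u : Vector ℝ n) {c} → 0# ≤ c → (∀ i → u i ≤ c) → max u ≤ c
  max-least {0}     u 0≤c u≤c = 0≤c
  max-least {suc n} u 0≤c u≤c =
    ⊔-lub (u≤c zero) (max-least (λ i → u (suc i)) 0≤c (λ i → u≤c (suc i)))

  max-cong : ∀ {n} {u v : Vector ℝ n} → (∀ i → u i ≈ v i) → max u ≈ max v
  max-cong {0}     u≈v = refl
  max-cong {suc n} u≈v = ⊔-cong (u≈v zero) (max-cong (λ i → u≈v (suc i)))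

  record MetricSpace : Set₁ where
    infix 4 _≋_
    field
      Point    : Set
      _≋_      : Rel Point 0ℓ
      dist     : Point → Point → ℝ
      isMetric : IsGeneralMetric _≋_ _≈_ _≤_ 0# _+_ dist

    open IsGeneralMetric isMetric public
      using (≈-isEquivalence; nonNegative; ≈⇒0; 0⇒≈; triangle)
      renaming (cong to dist-cong; sym to dist-sym)

  open MetricSpace public using (Point)

  line : MetricSpace
  line = record
    { Point    = ℝ
    ; _≋_      = _≈_
    ; dist     = λ x y → ∣ x - y ∣
    ; isMetric = record
      { isSemiMetric = record
        { isQuasiSemiMetric = record
          { isPreMetric = record
            { isProtoMetric = record
              { isPartialOrder  = isPartialOrder
              ; ≈-isEquivalence = isEquivalence
              ; cong            = λ p q → ∣∣-cong (+-cong p (-‿cong q))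
              ; nonNegative     = 0≤∣x∣ _
              }
            ; ≈⇒0 = λ {x} {y} p →
                trans (∣∣-cong (trans (+-cong p refl) (-‿inverseʳ y))) ∣0∣≈0
            }
          ; 0⇒≈ = λ {x} {y} p → trans (sym (cancel x y))
              (trans (+-cong (∣x∣≈0⇒x≈0 p) refl) (+-identityˡ y))
          }
        ; sym = λ x y → trans (sym (∣-x∣≈∣x∣ (x - y))) (∣∣-cong (flip-minus x y))
        }
      ; triangle = λ x y z → ≤-respˡ-≈
          (∣∣-cong (trans (sym (+-assoc (x - y) y (- z))) (+-cong (cancel x y) refl)))
          (∣x+y∣≤∣x∣+∣y∣ (x - y) (y - z))
      }
    }
    where
    cancel : ∀ x y → (x - y) + y ≈ x
    cancel x y = trans (+-assoc x (- y) y)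
                       (trans (+-cong refl (-‿inverseˡ y)) (+-identityʳ x))
    flip-minus : ∀ x y → - (x - y) ≈ y - x
    flip-minus x y = trans (sym (⁻¹-∙-comm x (- y)))
                           (trans (+-cong refl (-‿involutive y)) (+-comm (- x) y))

  -- Finite products carry the maximum metric, which induces the product
  -- topology; on ℝⁿ and ℂᵐ this is the Euclidean topology.

  infixr 2 _⊗_
  _⊗_ : MetricSpace → MetricSpace → MetricSpace
  X ⊗ Y = record
    { Point    = Point X × Point Y
    ; _≋_      = λ (x , y) (x′ , y′) → (x X.≋ x′) × (y Y.≋ y′)
    ; dist     = λ (x , y) (x′ , y′) → X.dist x x′ ⊔ Y.dist y y′
    ; isMetric = record
      { isSemiMetric = record
        { isQuasiSemiMetric = record
          { isPreMetric = record
            { isProtoMetric = record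
              { isPartialOrder  = isPartialOrder
              ; ≈-isEquivalence = record
                { refl  = XE.refl , YE.refl
                ; sym   = λ (p , q) → XE.sym p , YE.sym q
                ; trans = λ (p , q) (p′ , q′) → XE.trans p p′ , YE.trans q q′
                }
              ; cong        = λ (p , q) (p′ , q′) → ⊔-cong (X.dist-cong p p′) (Y.dist-cong q q′)
              ; nonNegative = ≤-trans X.nonNegative (x≤x⊔y _ _)
              }
            ; ≈⇒0 = λ (p , q) → trans (⊔-cong (X.≈⇒0 p) (Y.≈⇒0 q)) (⊔-idem 0#)
            }
          ; 0⇒≈ = λ p → X.0⇒≈ (antisym (≤-respʳ-≈ p (x≤x⊔y _ _)) X.nonNegative)
                      , Y.0⇒≈ (antisym (≤-respʳ-≈ p (x≤y⊔x _ _)) Y.nonNegative)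
          }
        ; sym = λ (x , y) (x′ , y′) → ⊔-cong (X.dist-sym x x′) (Y.dist-sym y y′)
        }
      ; triangle = λ (x , y) (x′ , y′) (x″ , y″) → ⊔-lub
          (≤-trans (X.triangle x x′ x″) (+-mono-≤ (x≤x⊔y _ _) (x≤x⊔y _ _)))
          (≤-trans (Y.triangle y y′ y″) (+-mono-≤ (x≤y⊔x _ _) (x≤y⊔x _ _)))
      }
    }
    where
    module X  = MetricSpace X
    module Y  = MetricSpace Y
    module XE = IsEquivalence X.≈-isEquivalence
    module YE = IsEquivalence Y.≈-isEquivalence

  infix 8 _^_
  _^_ : MetricSpace → ℕ → MetricSpace
  X ^ n = record
    { Point    = Vector (Point X) n
    ; _≋_      = λ x y → ∀ i → x i X.≋ y i
    ; dist     = λ x y → max (dists x y)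
    ; isMetric = record
      { isSemiMetric = record
        { isQuasiSemiMetric = record
          { isPreMetric = record
            { isProtoMetric = record
              { isPartialOrder  = isPartialOrder
              ; ≈-isEquivalence = record
                { refl  = λ _ → XE.refl
                ; sym   = λ p i → XE.sym (p i)
                ; trans = λ p q i → XE.trans (p i) (q i)
                }
              ; cong        = λ p q → max-cong (λ i → X.dist-cong (p i) (q i))
              ; nonNegative = λ {x} {y} → 0≤max (dists x y)
              }
            ; ≈⇒0 = λ {x} {y} p → antisym
                (max-least (dists x y) ≤-refl (λ i → ≤-reflexive (X.≈⇒0 (p i))))
                (0≤max (dists x y))
            }
          ; 0⇒≈ = λ {x} {y} p i →
              X.0⇒≈ (antisym (≤-respʳ-≈ p (u≤max (dists x y) i)) X.nonNegative)
          }
        ; sym = λ x y → max-cong (λ i → X.dist-sym (x i) (y i))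
        }
      ; triangle = λ x y z → max-least (dists x z)
          (≤-respˡ-≈ (+-identityˡ 0#)
            (+-mono-≤ (0≤max (dists x y)) (0≤max (dists y z))))
          (λ i → ≤-trans (X.triangle (x i) (y i) (z i))
            (+-mono-≤ (u≤max (dists x y) i) (u≤max (dists y z) i)))
      }
    }
    where
    module X  = MetricSpace X
    module XE = IsEquivalence X.≈-isEquivalence

    dists : Vector X.Point n → Vector X.Point n → Vector ℝ n
    dists x y i = X.dist (x i) (y i)

  subspace : (X : MetricSpace) → Pred (Point X) 0ℓ → MetricSpace
  subspace X S = record
    { Point    = Σ (Point X) S
    ; _≋_      = X._≋_ on proj₁
    ; dist     = X.dist on proj₁
    ; isMetric = record
      { isSemiMetric = record
        { isQuasiSemiMetric = record
          { isPreMetric = record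
            { isProtoMetric = record
              { isPartialOrder  = isPartialOrder
              ; ≈-isEquivalence = record { refl = XE.refl ; sym = XE.sym ; trans = XE.trans }
              ; cong            = X.dist-cong
              ; nonNegative     = X.nonNegative
              }
            ; ≈⇒0 = X.≈⇒0
            }
          ; 0⇒≈ = X.0⇒≈
          }
        ; sym = λ x y → X.dist-sym (proj₁ x) (proj₁ y)
        }
      ; triangle = λ x y z → X.triangle (proj₁ x) (proj₁ y) (proj₁ z)
      }
    }
    where
    module X  = MetricSpace X
    module XE = IsEquivalence X.≈-isEquivalence

  pullback : (X Y Z : MetricSpace) → (Point X → Point Z) → (Point Y → Point Z) → MetricSpace
  pullback X Y Z f g = subspace (X ⊗ Y) (λ (x , y) → f x Z.≋ g y)
    where module Z = MetricSpace Z

  record ContinuousMap (X Y : MetricSpace) : Set where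
    private
      module X = MetricSpace X
      module Y = MetricSpace Y
    field
      to         : Point X → Point Y
      cong       : ∀ {x x′} → x X.≋ x′ → to x Y.≋ to x′
      continuous : ∀ x ε → 0# < ε →
                   ∃[ δ ] 0# < δ × (∀ x′ → X.dist x x′ < δ → Y.dist (to x) (to x′) < ε)

  open ContinuousMap public using (to)

  unitInterval : MetricSpace
  unitInterval = subspace line (λ t → 0# ≤ t × t ≤ 1#)

  start end : Point unitInterval
  start = 0# , ≤-refl , 0≤1
  end   = 1# , 0≤1 , ≤-refl

  record Homotopic (X Y : MetricSpace) (f g : Point X → Point Y) : Set where
    private module Y = MetricSpace Y
    field
      homotopy : ContinuousMap (X ⊗ unitInterval) Y
      at-start : ∀ x → to homotopy (x , start) Y.≋ f x
      at-end   : ∀ x → to homotopy (x , end) Y.≋ g x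

  infix 4 _≃_
  record _≃_ (X Y : MetricSpace) : Set where
    field
      f   : ContinuousMap X Y
      g   : ContinuousMap Y X
      g∘f : Homotopic X X (λ x → to g (to f x)) (λ x → x)
      f∘g : Homotopic Y Y (λ y → to f (to g y)) (λ y → y)

  infix 7 ⟨_,_⟩
  ⟨_,_⟩ : ∀ {n} → Vector ℝ n → Vector ℝ n → ℝ
  ⟨_,_⟩ {n} x y = ∑[ i < n ] (x i * y i)

  AffinelyIndependent : ∀ {n k} → Vector (Vector ℝ n) k → Set
  AffinelyIndependent {n} {k} v = (c : Vector ℝ k) →
    sum c ≈ 0# → (∀ i → ∑[ j < k ] (c j * v j i) ≈ 0#) → ∀ j → c j ≈ 0#

  HasIndependentPoints : ∀ {n} → Pred (Vector ℝ n) 0ℓ → ℕ → Set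
  HasIndependentPoints {n} S k =
    Σ (Vector (Vector ℝ n) k) λ v → (∀ j → v j ∈ S) × AffinelyIndependent v

  -- The affine hull of S has dimension k. As k is a natural number, the
  -- empty set has no dimension.
  HasDimension : ∀ {n} → Pred (Vector ℝ n) 0ℓ → ℕ → Set
  HasDimension S k =
    HasIndependentPoints S (suc k) × ¬ HasIndependentPoints S (suc (suc k))

  IsFace : ∀ {n} → Pred (Vector ℝ n) 0ℓ → Pred (Vector ℝ n) 0ℓ → Set
  IsFace S F = ∃₂ λ c d →
    (∀ {x} → x ∈ S → 0# ≤ ⟨ c , x ⟩ + d) ×
    F ≐ (λ x → x ∈ S × ⟨ c , x ⟩ + d ≈ 0#)

  IsFacet : ∀ {n} → Pred (Vector ℝ n) 0ℓ → Pred (Vector ℝ n) 0ℓ → Set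
  IsFacet S F = IsFace S F × ∃[ k ] HasDimension S (suc k) × HasDimension F k

  module _ {n m} (a : Vector (Vector ℝ n) m) (b : Vector ℝ m) where

    slack : Vector ℝ n → Vector ℝ m
    slack x i = ⟨ a i , x ⟩ + b i

    Polyhedron : Pred (Vector ℝ n) 0ℓ
    Polyhedron x = ∀ i → 0# ≤ slack x i

    Wall : Fin m → Pred (Vector ℝ n) 0ℓ
    Wall i x = x ∈ Polyhedron × slack x i ≈ 0#

  record Polytope (n m : ℕ) : Set₁ where
    field
      a : Vector (Vector ℝ n) m
      b : Vector ℝ m

    P : Pred (Vector ℝ n) 0ℓ
    P = Polyhedron a b

    𝓕 : Fin m → Pred (Vector ℝ n) 0ℓ
    𝓕 = Wall a b

    space : MetricSpace
    space = subspace (line ^ n) P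

    field
      bounded         : Bounded _≤_ (MetricSpace.dist space)
      fullDimensional : HasDimension P n
      𝓕-facet         : ∀ i → IsFacet P (𝓕 i)
      facet-𝓕         : (F : Pred (Vector ℝ n) 0ℓ) → IsFacet P F → ∃[ i ] F ≐ 𝓕 i
      𝓕-distinct      : ∀ i j → 𝓕 i ≐ 𝓕 j → i ≡ j

  record SimplicialComplex (m : ℕ) : Set₁ where
    field
      Simplex     : Pred (Subset m) 0ℓ
      empty       : Simplex ∅ₛ
      down-closed : ∀ {α β} → α ⊆ β → Simplex β → Simplex α

  K : ∀ {n m} → Polytope n m → SimplicialComplex m
  K Q = record
    { Simplex     = λ α → Empty α ⊎ (∃[ x ] ∀ {i} → i ∈ₛ α → x ∈ 𝓕 i)
    ; empty       = inj₁ (λ (i , i∈∅) → ∉⊥ i∈∅)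
    ; down-closed = λ where
        α⊆β (inj₁ β-empty) → inj₁ (λ (i , i∈α) → β-empty (i , α⊆β i∈α))
        α⊆β (inj₂ (x , h)) → inj₂ (x , λ i∈α → h (α⊆β i∈α))
    }
    where open Polytope Q

  complexLine : MetricSpace
  complexLine = line ⊗ line

  ℂ : Set
  ℂ = Point complexLine

  ∣_∣² : ℂ → ℝ
  ∣ x , y ∣² = x * x + y * y

  -- For real r ≥ 0, r ≤ 1 iff r² ≤ 1 and r = 1 iff r² = 1.
  D² S¹ : Pred ℂ 0ℓ
  D² z = ∣ z ∣² ≤ 1#
  S¹ z = ∣ z ∣² ≈ 1#

  momentAngleComplex : ∀ {m} → SimplicialComplex m → MetricSpace
  momentAngleComplex {m} 𝓚 = subspace (complexLine ^ m) λ z →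
    ∃[ α ] Simplex α × (∀ i → (i ∈ₛ α → z i ∈ D²) × (i ∉ₛ α → z i ∈ S¹))
    where open SimplicialComplex 𝓚

  orthant : ℕ → MetricSpace
  orthant m = subspace (line ^ m) (λ y → ∀ i → 0# ≤ y i)

  p : ∀ {m} → Vector ℂ m → Point (orthant m)
  p z = (λ i → ∣ z i ∣²) , λ i →
    ≤-respˡ-≈ (+-identityˡ 0#) (+-mono-≤ (0≤x² (proj₁ (z i))) (0≤x² (proj₂ (z i))))

  j : ∀ {n m} (Q : Polytope n m) → Point (Polytope.space Q) → Point (orthant m)
  j Q (x , x∈P) = slack a b x , x∈P
    where open Polytope Q

  momentAngleSpace : ∀ {n m} → Polytope n m → MetricSpace
  momentAngleSpace {n} {m} Q =
    pullback (Polytope.space Q) (complexLine ^ m) (orthant m) (j Q) p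

{-# OPTIONS --safe #-}
module Submission where

open import Defs
open import Level using (0ℓ)
open import Axiom.ExcludedMiddle using (ExcludedMiddle)
open import Data.Nat using (ℕ)
import Algebra.Construct.NaturalChoice.Max as Max
import Algebra.Construct.NaturalChoice.Min as Min
import Algebra.Properties.AbelianGroup as AbelianGroupProperties
import Algebra.Properties.Ring as RingProperties
import Algebra.Properties.Semiring.Mult.TCOptimised as Mult
import Algebra.Solver.Ring as RingSolver
open import Algebra.Solver.Ring.AlmostCommutativeRing
  using (_-Raw-AlmostCommutative⟶_; fromCommutativeRing)
open import Data.Bool.Base using (if_then_else_)
open import Data.Fin.Base using (Fin; zero; suc)
open import Data.Fin.Subset using (Subset; Nonempty; inside; outside; _∉_)
open import Data.Integer.Base as ℤ using (ℤ; +_; -[1+_]; _⊖_; _◃_)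
import Data.Integer.Properties as ℤ
open import Data.Maybe.Base using (Maybe; map)
import Data.Nat.Base as ℕ
import Data.Nat.Properties as ℕ
open import Data.Product.Base using (∃; ∃-syntax; _×_; _,_; proj₁; proj₂)
import Data.Sign.Base as Sign
open import Data.Sum.Base as Sum using (_⊎_; inj₁; inj₂; [_,_]′)
open import Data.Vec.Base using ([]; _∷_; lookup; tabulate)
open import Data.Vec.Functional using (Vector; foldr)
open import Data.Vec.Properties using (lookup∘tabulate; []=⇒lookup; lookup⇒[]=)
open import Function.Base using (case_of_)
import Relation.Binary.Construct.NonStrictToStrict as NonStrictToStrict
open import Relation.Binary.PropositionalEquality.Core as ≡ using (_≡_)
import Relation.Binary.Reasoning.Setoid as SetoidReasoning
open import Relation.Nullary.Decidable.Core using (Dec; yes; no; does; dec⇒maybe; decidable-stable)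
open import Relation.Nullary.Negation using (¬_; contradiction)

-- Write ℓ for the slack functions and r for the vector of squared moduli.  Both
-- spaces fibre over their images under r: the polytope P, and the set C of those
-- r in [0,1]ᵐ for which the walls i with rᵢ ≠ 1 have a common point.  A map
-- between the bases that preserves vanishing of coordinates lifts by rescaling
-- each zᵢ to the new modulus, so it suffices to work on the bases.
--
-- ψ : C → P interpolates multilinearly between points x_σ chosen generically in
-- the faces F_σ.  φ : P → C is φ(x)ᵢ = min(1, ℓᵢ(x)/E(x)), where E(x) is the
-- maximum over nonempty F_σ of min(η, ℓᵢ(x) for i ∉ σ), with η > 0 a lower bound
-- for all nonzero ℓᵢ(x_σ).  E is positive on P, and the walls i with
-- ℓᵢ(x) < E(x) have a common point.  Straight lines join ψφ to the identity of P,
-- and also φψ to the identity of C: if y is common to the walls with rᵢ ≠ 1,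
-- genericity gives ℓᵢ(ψ(r)) ≥ η ≥ E(ψ(r)), hence φ(ψ(r))ᵢ = 1, off the walls
-- through y.

module _ (em : ExcludedMiddle 0ℓ) (𝐑 : CompleteOrderedField) where
  open OverReals 𝐑

  -- To cancel terms, the ring solver needs coefficients with decidable equality.
  module ℤ-coefficients where
    open Mult semiring using (×-homo-+; ×1-homo-*; 1+×) renaming (_×_ to infixr 8 _×ᶜ_)
    open RingProperties ring using (-0#≈0#; -‿involutive; -‿distribˡ-*; -‿distribʳ-*)
    open AbelianGroupProperties +-abelianGroup using (⁻¹-∙-comm)
    open SetoidReasoning setoid

    ⟦_⟧ : ℤ → ℝ
    ⟦ + n ⟧      = n ×ᶜ 1#
    ⟦ -[1+ n ] ⟧ = - (ℕ.suc n ×ᶜ 1#)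

    -‿homo : ∀ i → ⟦ ℤ.- i ⟧ ≈ - ⟦ i ⟧
    -‿homo (+ ℕ.zero)  = sym -0#≈0#
    -‿homo (+ ℕ.suc n) = refl
    -‿homo -[1+ n ]    = sym (-‿involutive _)

    ⊖-homo : ∀ k l → ⟦ k ⊖ l ⟧ ≈ k ×ᶜ 1# - l ×ᶜ 1#
    ⊖-homo ℕ.zero    ℕ.zero    = sym (-‿inverseʳ 0#)
    ⊖-homo ℕ.zero    (ℕ.suc l) = sym (+-identityˡ _)
    ⊖-homo (ℕ.suc k) ℕ.zero    = sym (trans (+-congˡ -0#≈0#) (+-identityʳ _))
    ⊖-homo (ℕ.suc k) (ℕ.suc l) = begin
      ⟦ ℕ.suc k ⊖ ℕ.suc l ⟧                    ≡⟨ ≡.cong ⟦_⟧ (ℤ.[1+m]⊖[1+n]≡m⊖n k l) ⟩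
      ⟦ k ⊖ l ⟧                                ≈⟨ ⊖-homo k l ⟩
      k ×ᶜ 1# - l ×ᶜ 1#                          ≈⟨ +-congʳ (+-identityʳ _) ⟨
      (k ×ᶜ 1# + 0#) - l ×ᶜ 1#                   ≈⟨ +-congʳ (+-congˡ (-‿inverseʳ 1#)) ⟨
      (k ×ᶜ 1# + (1# - 1#)) - l ×ᶜ 1#            ≈⟨ +-congʳ (+-assoc _ _ _) ⟨
      ((k ×ᶜ 1# + 1#) - 1#) - l ×ᶜ 1#            ≈⟨ +-assoc _ _ _ ⟩
      (k ×ᶜ 1# + 1#) + (- 1# - l ×ᶜ 1#)          ≈⟨ +-cong (trans (+-comm _ _) (sym (1+× k 1#)))
                                                    (trans (⁻¹-∙-comm _ _) (-‿cong (sym (1+× l 1#)))) ⟩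
      ℕ.suc k ×ᶜ 1# - ℕ.suc l ×ᶜ 1#              ∎

    +-homo : ∀ i j → ⟦ i ℤ.+ j ⟧ ≈ ⟦ i ⟧ + ⟦ j ⟧
    +-homo (+ k)    (+ l)    = ×-homo-+ 1# k l
    +-homo (+ k)    -[1+ l ] = ⊖-homo k (ℕ.suc l)
    +-homo -[1+ k ] (+ l)    = trans (⊖-homo l (ℕ.suc k)) (+-comm _ _)
    +-homo -[1+ k ] -[1+ l ] = begin
      - ((2 ℕ.+ (k ℕ.+ l)) ×ᶜ 1#)              ≡⟨ ≡.cong (λ h → - (ℕ.suc h ×ᶜ 1#)) (≡.sym (ℕ.+-suc k l)) ⟩
      - ((ℕ.suc k ℕ.+ ℕ.suc l) ×ᶜ 1#)          ≈⟨ -‿cong (×-homo-+ 1# (ℕ.suc k) (ℕ.suc l)) ⟩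
      - (ℕ.suc k ×ᶜ 1# + ℕ.suc l ×ᶜ 1#)         ≈⟨ ⁻¹-∙-comm _ _ ⟨
      - (ℕ.suc k ×ᶜ 1#) - ℕ.suc l ×ᶜ 1#         ∎

    ◃-homo⁻ : ∀ k → ⟦ Sign.- ◃ k ⟧ ≈ - (k ×ᶜ 1#)
    ◃-homo⁻ ℕ.zero    = sym -0#≈0#
    ◃-homo⁻ (ℕ.suc k) = refl

    ◃-homo⁺ : ∀ k → ⟦ Sign.+ ◃ k ⟧ ≈ k ×ᶜ 1#
    ◃-homo⁺ ℕ.zero    = refl
    ◃-homo⁺ (ℕ.suc k) = refl

    *-homo : ∀ i j → ⟦ i ℤ.* j ⟧ ≈ ⟦ i ⟧ * ⟦ j ⟧
    *-homo (+ k)    (+ l)    = trans (◃-homo⁺ (k ℕ.* l)) (×1-homo-* k l)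
    *-homo (+ k)    -[1+ l ] = trans (◃-homo⁻ (k ℕ.* ℕ.suc l))
      (trans (-‿cong (×1-homo-* k (ℕ.suc l))) (-‿distribʳ-* _ _))
    *-homo -[1+ k ] (+ l)    = trans (◃-homo⁻ (ℕ.suc k ℕ.* l))
      (trans (-‿cong (×1-homo-* (ℕ.suc k) l)) (-‿distribˡ-* _ _))
    *-homo -[1+ k ] -[1+ l ] = begin
      (ℕ.suc k ℕ.* ℕ.suc l) ×ᶜ 1#             ≈⟨ ×1-homo-* (ℕ.suc k) (ℕ.suc l) ⟩
      ℕ.suc k ×ᶜ 1# * ℕ.suc l ×ᶜ 1#            ≈⟨ -‿involutive _ ⟨
      - - (ℕ.suc k ×ᶜ 1# * ℕ.suc l ×ᶜ 1#)      ≈⟨ -‿cong (-‿distribʳ-* _ _) ⟩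
      - (ℕ.suc k ×ᶜ 1# * - (ℕ.suc l ×ᶜ 1#))    ≈⟨ -‿distribˡ-* _ _ ⟩
      - (ℕ.suc k ×ᶜ 1#) * - (ℕ.suc l ×ᶜ 1#)    ∎

    homomorphism : ℤ.+-*-rawRing -Raw-AlmostCommutative⟶ fromCommutativeRing commutativeRing
    homomorphism = record
      { ⟦_⟧ = ⟦_⟧ ; +-homo = +-homo ; *-homo = *-homo ; -‿homo = -‿homo
      ; 0-homo = refl ; 1-homo = refl }

    _≟_ : ∀ i j → Maybe (⟦ i ⟧ ≈ ⟦ j ⟧)
    i ≟ j = map (λ i≡j → reflexive (≡.cong ⟦_⟧ i≡j)) (dec⇒maybe (i ℤ.≟ j))

  open ℤ-coefficients using (homomorphism) renaming (_≟_ to _≟ᶜ_)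
  open RingSolver _ _ homomorphism _≟ᶜ_ using (solve; _:=_; _:+_; _:*_; :-_; _:-_; con)
  open Max totalOrder using (⊔-lub; x≤x⊔y; x≤y⊔x; ⊔-sel)
  open Min totalOrder using (_⊓_; ⊓-glb; x⊓y≤x; x⊓y≤y; ⊓-sel)
  private
    module Strict = NonStrictToStrict _≈_ _≤_
    module ≈-Reasoning = SetoidReasoning setoid

  -- Inequalities and inverses in an ordered field.

  ≰⇒> : ∀ {x y} → ¬ (x ≤ y) → y < x
  ≰⇒> = Strict.≰⇒> sym ≤-reflexive total

  <⇒≱ : ∀ {x y} → x < y → ¬ (y ≤ x)
  <⇒≱ = Strict.<⇒≱ antisym

  <-≤-trans : ∀ {x y z} → x < y → y ≤ z → x < z
  <-≤-trans = Strict.<-≤-trans sym ≤-trans antisym ≤-respʳ-≈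

  ≤-<-trans : ∀ {x y z} → x ≤ y → y < z → x < z
  ≤-<-trans = Strict.≤-<-trans ≤-trans antisym ≤-respˡ-≈

  0<⇒≉0 : ∀ {x} → 0# < x → x ≉ 0#
  0<⇒≉0 (_ , 0≉x) x≈0 = 0≉x (sym x≈0)

  ≉0⇒0< : ∀ {x} → 0# ≤ x → x ≉ 0# → 0# < x
  ≉0⇒0< 0≤x x≉0 = 0≤x , λ 0≈x → x≉0 (sym 0≈x)

  0<1 : 0# < 1#
  0<1 = ≉0⇒0< 0≤1 1≉0

  -- Reduces an inequality to a nonnegative remainder and an identity left to the ring solver; most
  -- estimates below take this form.
  ≤-by : ∀ {x y} d → 0# ≤ d → x + d ≈ y → x ≤ y
  ≤-by {x} {y} d 0≤d x+d≈y =
    ≤-respˡ-≈ (+-identityˡ x) (≤-respʳ-≈ (trans (+-comm d x) x+d≈y) (+-monoˡ-≤ x 0≤d))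

  0≤y-x : ∀ {x y} → x ≤ y → 0# ≤ y - x
  0≤y-x {x} {y} x≤y = ≤-respˡ-≈ (-‿inverseʳ x) (+-monoˡ-≤ (- x) x≤y)

  +-cancelʳ-≤ : ∀ z {x y} → x + z ≤ y + z → x ≤ y
  +-cancelʳ-≤ z {x} {y} h = ≤-by _ (0≤y-x h)
    (solve 3 (λ x y z → x :+ ((y :+ z) :- (x :+ z)) := y) refl x y z)

  0≤+ : ∀ {x y} → 0# ≤ x → 0# ≤ y → 0# ≤ x + y
  0≤+ 0≤x 0≤y = ≤-respˡ-≈ (+-identityˡ 0#) (+-mono-≤ 0≤x 0≤y)

  0<+ : ∀ {x y} → 0# ≤ x → 0# < y → 0# < x + y
  0<+ {x} {y} 0≤x 0<y = <-≤-trans 0<y (≤-by x 0≤x (+-comm y x))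

  x≤x+y : ∀ x {y} → 0# ≤ y → x ≤ x + y
  x≤x+y x 0≤y = ≤-by _ 0≤y refl

  *-monoˡ-≤ : ∀ {z x y} → 0# ≤ z → x ≤ y → z * x ≤ z * y
  *-monoˡ-≤ {z} {x} {y} 0≤z x≤y = ≤-by _ (*-nonneg 0≤z (0≤y-x x≤y))
    (solve 3 (λ x y z → z :* x :+ z :* (y :- x) := z :* y) refl x y z)

  *-mono-≤ : ∀ {w x y z} → 0# ≤ w → 0# ≤ y → w ≤ x → y ≤ z → w * y ≤ x * z
  *-mono-≤ {w} {x} {y} {z} 0≤w 0≤y w≤x y≤z = ≤-by _
    (0≤+ (*-nonneg (0≤y-x w≤x) 0≤y) (*-nonneg (≤-trans 0≤w w≤x) (0≤y-x y≤z)))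
    (solve 4 (λ w x y z → w :* y :+ ((x :- w) :* y :+ x :* (z :- y)) := x :* z) refl w x y z)

  abstract
    -- The value 0 at 0 makes inversion total, so no proof of nonvanishing has to be carried along.
    -- `abstract` keeps the case distinction from unfolding.
    inv : ℝ → ℝ
    inv x with em {x ≈ 0#}
    ... | yes _  = 0#
    ... | no x≉0 = proj₁ (inverse x x≉0)

    *-inv : ∀ {x} → x ≉ 0# → x * inv x ≈ 1#
    *-inv {x} x≉0 with em {x ≈ 0#}
    ... | yes x≈0 = contradiction x≈0 x≉0
    ... | no x≉0′ = proj₂ (inverse x x≉0′)

  x*y≈0⇒y≈0 : ∀ {x y} → x ≉ 0# → x * y ≈ 0# → y ≈ 0#
  x*y≈0⇒y≈0 {x} {y} x≉0 xy≈0 = begin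
    y                 ≈⟨ *-identityˡ y ⟨
    1# * y            ≈⟨ *-congʳ (*-inv x≉0) ⟨
    x * inv x * y     ≈⟨ solve 3 (λ x z y → x :* z :* y := z :* (x :* y)) refl x (inv x) y ⟩
    inv x * (x * y)   ≈⟨ *-congˡ xy≈0 ⟩
    inv x * 0#        ≈⟨ zeroʳ (inv x) ⟩
    0#                ∎
    where open ≈-Reasoning

  x*x≈0⇒x≈0 : ∀ {x} → x * x ≈ 0# → x ≈ 0#
  x*x≈0⇒x≈0 {x} x²≈0 with em {x ≈ 0#}
  ... | yes x≈0 = x≈0
  ... | no x≉0  = x*y≈0⇒y≈0 x≉0 x²≈0

  0<* : ∀ {x y} → 0# < x → 0# < y → 0# < x * y
  0<* 0<x 0<y = ≉0⇒0< (*-nonneg (proj₁ 0<x) (proj₁ 0<y))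
    (λ xy≈0 → 0<⇒≉0 0<y (x*y≈0⇒y≈0 (0<⇒≉0 0<x) xy≈0))

  -- If `x` exceeded `y`, then `z * (x - y)` would be positive, while the hypothesis makes its
  -- negative nonnegative.
  *-cancelˡ-≤ : ∀ {z x y} → 0# < z → z * x ≤ z * y → x ≤ y
  *-cancelˡ-≤ {z} {x} {y} 0<z zx≤zy with em {x ≤ y}
  ... | yes x≤y = x≤y
  ... | no x≰y  = contradiction
    (≤-respʳ-≈ (solve 3 (λ x y z → z :* y :- z :* x := :- (z :* (x :- y))) refl x y z) (0≤y-x zx≤zy))
    (λ 0≤-d → <⇒≱ (0<* 0<z 0<x-y) (≤-by _ 0≤-d (-‿inverseʳ _)))
    where
    0<x-y : 0# < x - y
    0<x-y = ≉0⇒0< (0≤y-x (proj₁ (≰⇒> x≰y)))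
      (λ x-y≈0 → x≰y (≤-reflexive (trans (solve 2 (λ x y → x := (x :- y) :+ y) refl x y)
        (trans (+-congʳ x-y≈0) (+-identityˡ y)))))

  abstract
    0≤inv : ∀ {x} → 0# ≤ x → 0# ≤ inv x
    0≤inv {x} 0≤x with em {x ≈ 0#}
    ... | yes _  = ≤-refl
    ... | no x≉0 = *-cancelˡ-≤ (≉0⇒0< 0≤x x≉0)
      (≤-respˡ-≈ (sym (zeroʳ x)) (≤-respʳ-≈ (sym (proj₂ (inverse x x≉0))) 0≤1))

  0<inv : ∀ {x} → 0# < x → 0# < inv x
  0<inv {x} 0<x = ≉0⇒0< (0≤inv (proj₁ 0<x)) λ inv≈0 →
    1≉0 (trans (sym (*-inv (0<⇒≉0 0<x))) (trans (*-congˡ inv≈0) (zeroʳ x)))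

  ½ : ℝ
  ½ = inv (1# + 1#)

  0<½ : 0# < ½
  0<½ = 0<inv (0<+ 0≤1 0<1)

  ½+½≈1 : ½ + ½ ≈ 1#
  ½+½≈1 = trans (solve 1 (λ h → h :+ h := (con (+ 1) :+ con (+ 1)) :* h) refl ½)
                (*-inv (0<⇒≉0 (0<+ 0≤1 0<1)))

  ½*x+½*x≈x : ∀ x → ½ * x + ½ * x ≈ x
  ½*x+½*x≈x x = trans (sym (distribʳ x ½ ½)) (trans (*-congʳ ½+½≈1) (*-identityˡ x))

  -- Adding `x * y` to both sides gives `(y + x) * x ≤ (y + x) * y`, and if the claim failed,
  -- `y + x` would be positive and could be cancelled.
  square-cancel-≤ : ∀ {x y} → 0# ≤ y → x * x ≤ y * y → x ≤ y
  square-cancel-≤ {x} {y} 0≤y x²≤y² with em {x ≤ y}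
  ... | yes x≤y = x≤y
  ... | no x≰y  = *-cancelˡ-≤ (0<+ 0≤y (≤-<-trans 0≤y (≰⇒> x≰y)))
    (+-cancelʳ-≤ (- (x * y)) (≤-respˡ-≈ (lhs x y) (≤-respʳ-≈ (rhs x y) x²≤y²)))
    where
    lhs : ∀ x y → x * x ≈ (y + x) * x - x * y
    lhs = solve 2 (λ x y → x :* x := (y :+ x) :* x :- x :* y) refl
    rhs : ∀ x y → y * y ≈ (y + x) * y - x * y
    rhs = solve 2 (λ x y → y :* y := (y :+ x) :* y :- x :* y) refl

  square-cancel : ∀ {x y} → 0# ≤ x → 0# ≤ y → x * x ≈ y * y → x ≈ y
  square-cancel 0≤x 0≤y x²≈y² =
    antisym (square-cancel-≤ 0≤y (≤-reflexive x²≈y²)) (square-cancel-≤ 0≤x (≤-reflexive (sym x²≈y²)))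

  -- Limits of inequalities and square roots.

  -- If b < a, the hypothesis fails at h = (a - b) / (c + (a - b) + 1).
  ≤-limit : ∀ {a b} c → 0# ≤ c → (∀ h → 0# < h → h ≤ 1# → a ≤ b + h * c) → a ≤ b
  ≤-limit {a} {b} c 0≤c approx with em {a ≤ b}
  ... | yes a≤b = a≤b
  ... | no a≰b  = contradiction (approx h 0<h h≤1) (<⇒≱ b+hc<a)
    where
    d q h : ℝ
    d = a - b
    q = c + (d + 1#)
    h = d * inv q
    0≤d : 0# ≤ d
    0≤d = 0≤y-x (proj₁ (≰⇒> a≰b))
    0<d : 0# < d
    0<d = ≉0⇒0< 0≤d (λ d≈0 → a≰b (≤-reflexive (trans (solve 2 (λ a b → a := (a :- b) :+ b) refl a b)
        (trans (+-congʳ d≈0) (+-identityˡ b)))))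
    0<d+1 : 0# < d + 1#
    0<d+1 = 0<+ 0≤d 0<1
    0<q : 0# < q
    0<q = 0<+ 0≤c 0<d+1
    0<h : 0# < h
    0<h = 0<* 0<d (0<inv 0<q)
    h*q≈d : h * q ≈ d
    h*q≈d = trans (solve 3 (λ d i q → d :* i :* q := d :* (q :* i)) refl d (inv q) q)
                  (trans (*-congˡ (*-inv (0<⇒≉0 0<q))) (*-identityʳ d))
    h≤1 : h ≤ 1#
    h≤1 = *-cancelˡ-≤ 0<q (≤-by _ (0≤+ 0≤c 0≤1) (trans (+-congʳ (trans (*-comm q h) h*q≈d))
      (solve 2 (λ c d → d :+ (c :+ con (+ 1)) := (c :+ (d :+ con (+ 1))) :* con (+ 1)) refl c d)))
    b+hc<a : b + h * c < a
    b+hc<a = ≤-by _ (proj₁ 0<r) eq , λ b+hc≈a → 0<⇒≉0 0<r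
      (trans (solve 2 (λ x r → r := (x :+ r) :- x) refl (b + h * c) r)
        (trans (+-cong (trans eq (sym b+hc≈a)) refl) (-‿inverseʳ _)))
      where
      -- Since `h * q ≈ d`, the number `a` splits as `b + h * c` plus this positive remainder.
      r : ℝ
      r = h * (d + 1#)
      0<r : 0# < r
      0<r = 0<* 0<h 0<d+1
      eq : b + h * c + r ≈ a
      eq = trans (solve 4 (λ b h c e → b :+ h :* c :+ h :* e := b :+ h :* (c :+ e)) refl b h c (d + 1#))
        (trans (+-congˡ h*q≈d) (solve 2 (λ a b → b :+ (a :- b) := a) refl a b))

  square-mono : ∀ {x y} → 0# ≤ x → x ≤ y → x * x ≤ y * y
  square-mono 0≤x x≤y = *-mono-≤ 0≤x 0≤x x≤y x≤y

  -- For 0 < h ≤ 1, s - h is exceeded by some y in S and s + h is not below S.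
  sup-square : ∀ {x} → 0# ≤ x → let S = λ y → y * y ≤ x in
               ∀ {s} → UpperBound S s → (∀ {u} → UpperBound S u → s ≤ u) →
               0# ≤ s × s * s ≈ x
  sup-square {x} 0≤x {s} upper least = 0≤s , antisym (≤-limit c 0≤c s²≤) (≤-limit c 0≤c ≤s²)
    where
    S : ℝ → Set
    S y = y * y ≤ x
    -- For `y ≤ s` and `0 ≤ h ≤ 1`, squaring `y + h` adds `h * (y + y + h)` to the square of `y`,
    -- which is at most `h * c`.
    c : ℝ
    c = s + s + 1#
    0≤s : 0# ≤ s
    0≤s = upper (≤-respˡ-≈ (sym (zeroˡ 0#)) 0≤x)
    0≤c : 0# ≤ c
    0≤c = 0≤+ (0≤+ 0≤s 0≤s) 0≤1
    [y+h]²≤ : ∀ {y h} → 0# ≤ h → h ≤ 1# → y ≤ s → (y + h) * (y + h) ≤ y * y + h * c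
    [y+h]²≤ {y} {h} 0≤h h≤1 y≤s = ≤-by _
      (*-nonneg 0≤h (0≤+ (0≤+ (0≤y-x y≤s) (0≤y-x y≤s)) (0≤y-x h≤1)))
      (solve 3 (λ y h s → (y :+ h) :* (y :+ h) :+ h :* ((s :- y) :+ (s :- y) :+ (con (+ 1) :- h))
        := y :* y :+ h :* (s :+ s :+ con (+ 1))) refl y h s)
    s²≤ : ∀ h → 0# < h → h ≤ 1# → s * s ≤ x + h * c
    s²≤ h 0<h h≤1 with em {∃[ y ] S y × s - h ≤ y}
    ... | yes (y , y²≤x , s-h≤y) = ≤-trans (square-mono 0≤s s≤y+h)
            (≤-trans ([y+h]²≤ (proj₁ 0<h) h≤1 (upper y²≤x)) (+-monoˡ-≤ _ y²≤x))
      where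
      s≤y+h : s ≤ y + h
      s≤y+h = ≤-respˡ-≈ (solve 2 (λ s h → (s :- h) :+ h := s) refl s h) (+-monoˡ-≤ h s-h≤y)
    ... | no none = contradiction
            (+-cancelʳ-≤ (s - h) (≤-respˡ-≈ (solve 2 (λ s h → s := h :+ (s :- h)) refl s h)
              (≤-respʳ-≈ (sym (+-identityˡ _)) (least (λ {y} y∈S →
                [ (λ y≤ → y≤) , (λ ≤y → contradiction (y , y∈S , ≤y) none) ]′ (total y (s - h)))))))
            (<⇒≱ 0<h)
    ≤s² : ∀ h → 0# < h → h ≤ 1# → x ≤ s * s + h * c
    ≤s² h 0<h h≤1 with total x ((s + h) * (s + h))
    ... | inj₁ x≤ = ≤-trans x≤ ([y+h]²≤ (proj₁ 0<h) h≤1 ≤-refl)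
    ... | inj₂ ≤x = contradiction
            (+-cancelʳ-≤ s (≤-respˡ-≈ (+-comm s h) (≤-respʳ-≈ (sym (+-identityˡ s)) (upper ≤x))))
            (<⇒≱ 0<h)

  sqrt-exists : ∀ {x} → 0# ≤ x → ∃[ s ] 0# ≤ s × s * s ≈ x
  sqrt-exists {x} 0≤x =
    let s , upper , least = supremum S (0# , ≤-respˡ-≈ (sym (zeroˡ 0#)) 0≤x) (x + 1# , bound)
    in s , sup-square 0≤x upper least
    where
    S : ℝ → Set
    S y = y * y ≤ x
    -- `x + 1#` works for small and large `x` alike, as its square is at least `x` whenever `x` is
    -- nonnegative.
    bound : UpperBound S (x + 1#)
    bound {y} y²≤x = square-cancel-≤ (0≤+ 0≤x 0≤1) (≤-trans y²≤x
      (≤-by _ (0≤+ (*-nonneg 0≤x 0≤x) (0≤+ 0≤x 0≤1))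
        (solve 1 (λ x → x :+ (x :* x :+ (x :+ con (+ 1))) := (x :+ con (+ 1)) :* (x :+ con (+ 1))) refl x)))

  abstract
    √ : ℝ → ℝ
    √ x with em {0# ≤ x}
    ... | yes 0≤x = proj₁ (sqrt-exists 0≤x)
    ... | no _    = 0#

    0≤√ : ∀ x → 0# ≤ √ x
    0≤√ x with em {0# ≤ x}
    ... | yes 0≤x = proj₁ (proj₂ (sqrt-exists 0≤x))
    ... | no _    = ≤-refl

    √*√ : ∀ {x} → 0# ≤ x → √ x * √ x ≈ x
    √*√ {x} 0≤x with em {0# ≤ x}
    ... | yes 0≤x′ = proj₂ (proj₂ (sqrt-exists 0≤x′))
    ... | no 0≰x   = contradiction 0≤x 0≰x

  -- Estimates for absolute values.

  x≤∣x∣ : ∀ x → x ≤ ∣ x ∣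
  x≤∣x∣ x = x≤x⊔y x (- x)

  ∣∣≤ : ∀ {x c} → x ≤ c → - x ≤ c → ∣ x ∣ ≤ c
  ∣∣≤ = ⊔-lub

  ∣x-y∣≤ : ∀ {x y c} → x ≤ y + c → y ≤ x + c → ∣ x - y ∣ ≤ c
  ∣x-y∣≤ {x} {y} {c} x≤ y≤ = ∣∣≤
    (≤-by _ (0≤y-x x≤) (solve 3 (λ x y c → x :- y :+ (y :+ c :- x) := c) refl x y c))
    (≤-by _ (0≤y-x y≤) (solve 3 (λ x y c → :- (x :- y) :+ (x :+ c :- y) := c) refl x y c))

  ∣x-y∣≤⇒x≤y+ : ∀ {x y c} → ∣ x - y ∣ ≤ c → x ≤ y + c
  ∣x-y∣≤⇒x≤y+ {x} {y} {c} h = ≤-by _ (0≤y-x (≤-trans (x≤∣x∣ (x - y)) h))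
    (solve 3 (λ x y c → x :+ (c :- (x :- y)) := y :+ c) refl x y c)

  ∣x-y∣≤⇒y≤x+ : ∀ {x y c} → ∣ x - y ∣ ≤ c → y ≤ x + c
  ∣x-y∣≤⇒y≤x+ {x} {y} {c} h = ≤-by _ (0≤y-x (≤-trans (x≤y⊔x (x - y) (- (x - y))) h))
    (solve 3 (λ x y c → y :+ (c :- (:- (x :- y))) := x :+ c) refl x y c)

  -- The difference `c * d - x * y` is half the sum of `(c - x) * (d + y)` and `(c + x) * (d - y)`,
  -- whose factors are all nonnegative.
  x*y≤ : ∀ {x y c d} → ∣ x ∣ ≤ c → ∣ y ∣ ≤ d → x * y ≤ c * d
  x*y≤ {x} {y} {c} {d} ∣x∣≤c ∣y∣≤d = ≤-by _
    (*-nonneg (proj₁ 0<½) (0≤+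
      (*-nonneg (0≤y-x (≤-trans (x≤∣x∣ x) ∣x∣≤c)) (0≤y-x (≤-trans (x≤y⊔x y (- y)) ∣y∣≤d)))
      (*-nonneg (0≤y-x (≤-trans (x≤y⊔x x (- x)) ∣x∣≤c)) (0≤y-x (≤-trans (x≤∣x∣ y) ∣y∣≤d)))))
    (trans (+-congˡ (trans (solve 5 (λ x y c d h → h :* ((c :- x) :* (d :- :- y) :+ (c :- :- x) :* (d :- y))
          := h :* (c :* d :- x :* y) :+ h :* (c :* d :- x :* y)) refl x y c d ½) (½*x+½*x≈x _)))
      (solve 2 (λ p q → p :+ (q :- p) := q) refl (x * y) (c * d)))

  ∣x*y∣≤ : ∀ {x y c d} → ∣ x ∣ ≤ c → ∣ y ∣ ≤ d → ∣ x * y ∣ ≤ c * d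
  ∣x*y∣≤ {x} {y} ∣x∣≤c ∣y∣≤d = ∣∣≤ (x*y≤ ∣x∣≤c ∣y∣≤d)
    (≤-respˡ-≈ (solve 2 (λ x y → :- x :* y := :- (x :* y)) refl x y)
      (x*y≤ (≤-respˡ-≈ (sym (∣-x∣≈∣x∣ x)) ∣x∣≤c) ∣y∣≤d))

  0<⊓ : ∀ {x y} → 0# < x → 0# < y → 0# < x ⊓ y
  0<⊓ {x} {y} 0<x 0<y with ⊓-sel x y
  ... | inj₁ eq = <-≤-trans 0<x (≤-reflexive (sym eq))
  ... | inj₂ eq = <-≤-trans 0<y (≤-reflexive (sym eq))

  ½*x<x : ∀ {x} → 0# < x → ½ * x < x
  ½*x<x {x} 0<x = ≤-by _ (proj₁ (0<* 0<½ 0<x)) (½*x+½*x≈x x) ,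
    λ eq → 0<⇒≉0 (0<* 0<½ 0<x) (trans (solve 1 (λ y → y := (y :+ y) :- y) refl (½ * x))
      (trans (+-cong (½*x+½*x≈x x) (-‿cong eq)) (-‿inverseʳ x)))

  -- Calculus of functions continuous at a point.

  module Pointwise (X : MetricSpace) (x₀ : Point X) where
    private module X = MetricSpace X

    Near : (Point X → Set) → Set
    Near A = ∃[ δ ] 0# < δ × (∀ x → X.dist x₀ x < δ → A x)

    near-map : ∀ {A B : Point X → Set} → (∀ x → A x → B x) → Near A → Near B
    near-map f (δ , 0<δ , h) = δ , 0<δ , λ x d → f x (h x d)

    near-∩ : ∀ {A B : Point X → Set} → Near A → Near B → Near (λ x → A x × B x)
    near-∩ (δ , 0<δ , h) (ε , 0<ε , k) = δ ⊓ ε , 0<⊓ 0<δ 0<ε ,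
      λ x d → h x (<-≤-trans d (x⊓y≤x δ ε)) , k x (<-≤-trans d (x⊓y≤y δ ε))

    near-map₂ : ∀ {A B C : Point X → Set} → (∀ x → A x → B x → C x) → Near A → Near B → Near C
    near-map₂ f a b = near-map (λ x (p , q) → f x p q) (near-∩ a b)

    near-∀ : ∀ {n} {A : Fin n → Point X → Set} → (∀ i → Near (A i)) → Near (λ x → ∀ i → A i x)
    near-∀ {ℕ.zero}  a = 1# , 0<1 , λ _ _ ()
    near-∀ {ℕ.suc n} a = near-map₂ (λ x p q → λ { zero → p ; (suc i) → q i })
      (a zero) (near-∀ (λ i → a (suc i)))

    -- The bound by `ε` is weak so that least upper bounds apply to it directly; `continuousMap`
    -- recovers the strict bound by halving `ε`.
    ContinuousTo : (Y : MetricSpace) → (Point X → Point Y) → Set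
    ContinuousTo Y f = ∀ ε → 0# < ε → Near (λ x → MetricSpace.dist Y (f x₀) (f x) ≤ ε)

    Continuous : (Point X → ℝ) → Set
    Continuous = ContinuousTo line

    continuous-into-⊗ : ∀ {Y Z} {f : Point X → Point (Y ⊗ Z)} →
                        ContinuousTo Y (λ x → proj₁ (f x)) → ContinuousTo Z (λ x → proj₂ (f x)) →
                        ContinuousTo (Y ⊗ Z) f
    continuous-into-⊗ u v ε 0<ε = near-map₂ (λ _ → ⊔-lub) (u ε 0<ε) (v ε 0<ε)

    continuous-into-^ : ∀ {n Y} {f : Point X → Point (Y ^ n)} →
                        (∀ i → ContinuousTo Y (λ x → f x i)) → ContinuousTo (Y ^ n) f
    continuous-into-^ u ε 0<ε =
      near-map (λ _ → max-least _ (proj₁ 0<ε)) (near-∀ (λ i → u i ε 0<ε))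

    nonexpansive⇒continuous : ∀ {Y} {f : Point X → Point Y} →
                              (∀ x → MetricSpace.dist Y (f x₀) (f x) ≤ X.dist x₀ x) → ContinuousTo Y f
    nonexpansive⇒continuous f≤ ε 0<ε = ε , 0<ε , λ x d → ≤-trans (f≤ x) (proj₁ d)

    continuous-const : ∀ c → Continuous (λ _ → c)
    continuous-const c = nonexpansive⇒continuous {line}
      (λ x → ≤-respˡ-≈ (sym (trans (∣∣-cong (-‿inverseʳ c)) ∣0∣≈0)) X.nonNegative)

    module _ {u v : Point X → ℝ} (cu : Continuous u) (cv : Continuous v) where

      continuous-+ : Continuous (λ x → u x + v x)
      continuous-+ ε 0<ε = near-map₂
        (λ x p q → ∣x-y∣≤
          (≤-respʳ-≈ (eq (u x) (v x)) (+-mono-≤ (∣x-y∣≤⇒x≤y+ p) (∣x-y∣≤⇒x≤y+ q)))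
          (≤-respʳ-≈ (eq (u x₀) (v x₀)) (+-mono-≤ (∣x-y∣≤⇒y≤x+ p) (∣x-y∣≤⇒y≤x+ q))))
        (cu (½ * ε) (0<* 0<½ 0<ε)) (cv (½ * ε) (0<* 0<½ 0<ε))
        where
        eq : ∀ a b → (a + ½ * ε) + (b + ½ * ε) ≈ (a + b) + ε
        eq a b = trans (solve 3 (λ a b e → (a :+ e) :+ (b :+ e) := (a :+ b) :+ (e :+ e)) refl a b (½ * ε))
          (+-congˡ (½*x+½*x≈x ε))

      continuous-⊔ : Continuous (λ x → u x ⊔ v x)
      continuous-⊔ ε 0<ε = near-map₂
        (λ x p q → ∣x-y∣≤ (lub (∣x-y∣≤⇒x≤y+ p) (∣x-y∣≤⇒x≤y+ q)) (lub (∣x-y∣≤⇒y≤x+ p) (∣x-y∣≤⇒y≤x+ q)))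
        (cu ε 0<ε) (cv ε 0<ε)
        where
        lub : ∀ {a b c d} → a ≤ c + ε → b ≤ d + ε → a ⊔ b ≤ (c ⊔ d) + ε
        lub p q = ⊔-lub (≤-trans p (+-monoˡ-≤ ε (x≤x⊔y _ _))) (≤-trans q (+-monoˡ-≤ ε (x≤y⊔x _ _)))

      continuous-⊓ : Continuous (λ x → u x ⊓ v x)
      continuous-⊓ ε 0<ε = near-map₂
        (λ x p q → ∣x-y∣≤ (glb (∣x-y∣≤⇒x≤y+ p) (∣x-y∣≤⇒x≤y+ q)) (glb (∣x-y∣≤⇒y≤x+ p) (∣x-y∣≤⇒y≤x+ q)))
        (cu ε 0<ε) (cv ε 0<ε)
        where
        glb : ∀ {a b c d} → a ≤ c + ε → b ≤ d + ε → a ⊓ b ≤ (c ⊓ d) + ε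
        glb {a} {b} {c} {d} p q with ⊓-sel c d
        ... | inj₁ eq = ≤-trans (x⊓y≤x a b) (≤-respʳ-≈ (+-congʳ (sym eq)) p)
        ... | inj₂ eq = ≤-trans (x⊓y≤y a b) (≤-respʳ-≈ (+-congʳ (sym eq)) q)

      continuous-* : Continuous (λ x → u x * v x)
      continuous-* ε 0<ε = near-map₂ close (cu δ 0<δ) (cv δ 0<δ)
        where
        -- With `δ = ε / (M + ε)` both `δ ≤ 1#` and `M * δ ≤ ε` hold. The summand `1#` of `M`
        -- absorbs the product of the two errors.
        M δ : ℝ
        M = ∣ u x₀ ∣ + ∣ v x₀ ∣ + 1#
        δ = ε * inv (M + ε)
        0≤M : 0# ≤ M
        0≤M = 0≤+ (0≤+ (0≤∣x∣ _) (0≤∣x∣ _)) 0≤1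
        0<M+ε : 0# < M + ε
        0<M+ε = 0<+ 0≤M 0<ε
        0<δ : 0# < δ
        0<δ = 0<* 0<ε (0<inv 0<M+ε)
        [M+ε]δ≈ε : (M + ε) * δ ≈ ε
        [M+ε]δ≈ε = trans (solve 3 (λ q e i → q :* (e :* i) := e :* (q :* i)) refl (M + ε) ε (inv (M + ε)))
          (trans (*-congˡ (*-inv (0<⇒≉0 0<M+ε))) (*-identityʳ ε))
        δ≤1 : δ ≤ 1#
        δ≤1 = *-cancelˡ-≤ 0<M+ε (≤-respˡ-≈ (sym [M+ε]δ≈ε) (≤-by M 0≤M
          (solve 2 (λ m e → e :+ m := (m :+ e) :* con (+ 1)) refl M ε)))
        Mδ≤ε : M * δ ≤ ε
        Mδ≤ε = ≤-by (ε * δ) (proj₁ (0<* 0<ε 0<δ)) (trans (sym (distribʳ δ M ε)) [M+ε]δ≈ε)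
        bound : ∀ {a b p q} → ∣ p ∣ ≤ δ → ∣ q ∣ ≤ δ →
                ∣ a * q + p * b + - p * q ∣ ≤ (∣ a ∣ + ∣ b ∣ + 1#) * δ
        bound {a} {b} {p} {q} ∣p∣≤δ ∣q∣≤δ = ≤-trans (∣x+y∣≤∣x∣+∣y∣ (a * q + p * b) (- p * q))
          (≤-trans (+-mono-≤
            (≤-trans (∣x+y∣≤∣x∣+∣y∣ (a * q) (p * b)) (+-mono-≤ (∣x*y∣≤ ≤-refl ∣q∣≤δ) (∣x*y∣≤ ∣p∣≤δ ≤-refl)))
            (∣x*y∣≤ (≤-respˡ-≈ (sym (∣-x∣≈∣x∣ p)) (≤-trans ∣p∣≤δ δ≤1)) ∣q∣≤δ))
          (≤-reflexive (solve 3 (λ a b d → a :* d :+ d :* b :+ con (+ 1) :* d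
            := (a :+ b :+ con (+ 1)) :* d) refl ∣ a ∣ ∣ b ∣ δ)))
        close : ∀ x → ∣ u x₀ - u x ∣ ≤ δ → ∣ v x₀ - v x ∣ ≤ δ → ∣ u x₀ * v x₀ - u x * v x ∣ ≤ ε
        close x p q = ≤-trans (≤-respˡ-≈ (∣∣-cong (expand (u x₀) (v x₀) (u x) (v x)))
          (bound p q)) Mδ≤ε
          where
          expand : ∀ a b c d → a * (b - d) + (a - c) * b + - (a - c) * (b - d) ≈ a * b - c * d
          expand = solve 4 (λ a b c d → a :* (b :- d) :+ (a :- c) :* b :+ (:- (a :- c)) :* (b :- d)
            := a :* b :- c :* d) refl

    continuous-neg : ∀ {u} → Continuous u → Continuous (λ x → - u x)
    continuous-neg {u} cu ε 0<ε = near-map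
      (λ x → ≤-respˡ-≈ (trans (sym (∣-x∣≈∣x∣ _)) (∣∣-cong (flip (u x₀) (u x))))) (cu ε 0<ε)
      where
      flip : ∀ a b → - (a - b) ≈ - a - - b
      flip = solve 2 (λ a b → :- (a :- b) := :- a :- :- b) refl

    -- A change of at most the square of `ε` under the root moves the root by at most `ε`, even near
    -- 0.
    continuous-√ : ∀ {u} → (∀ x → 0# ≤ u x) → Continuous u → Continuous (λ x → √ (u x))
    continuous-√ {u} 0≤u cu ε 0<ε = near-map
      (λ x p → ∣x-y∣≤ (√≤ (0≤u x₀) (0≤u x) (∣x-y∣≤⇒x≤y+ p)) (√≤ (0≤u x) (0≤u x₀) (∣x-y∣≤⇒y≤x+ p)))
      (cu (ε * ε) (0<* 0<ε 0<ε))
      where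
      √≤ : ∀ {a b} → 0# ≤ a → 0# ≤ b → a ≤ b + ε * ε → √ a ≤ √ b + ε
      √≤ {a} {b} 0≤a 0≤b a≤ = square-cancel-≤ (0≤+ (0≤√ b) (proj₁ 0<ε))
        (≤-respˡ-≈ (sym (√*√ 0≤a)) (≤-trans a≤ (≤-trans (+-monoˡ-≤ (ε * ε) (≤-reflexive (sym (√*√ 0≤b))))
          (≤-by _ (0≤+ (*-nonneg (0≤√ b) (proj₁ 0<ε)) (*-nonneg (0≤√ b) (proj₁ 0<ε)))
            (solve 2 (λ s e → s :* s :+ e :* e :+ (s :* e :+ s :* e) := (s :+ e) :* (s :+ e)) refl (√ b) ε)))))

    continuous-inv : ∀ {u} → 0# < u x₀ → Continuous u → Continuous (λ x → inv (u x))
    continuous-inv {u} 0<u cu ε 0<ε = near-map₂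
      (λ x p q → let 0<ux = <-≤-trans 0<h (≤-by _ (0≤y-x (∣x-y∣≤⇒x≤y+ p)) (half (u x)))
                     d≤ = *-monoˡ-≤ (proj₁ (0<* 0<ε 0<u)) (≤-by _ (0≤y-x (∣x-y∣≤⇒x≤y+ p)) (half (u x)))
        in ∣x-y∣≤
          (inv≤ 0<u 0<ux (≤-trans (∣x-y∣≤⇒y≤x+ q) (≤-respˡ-≈ (+-comm _ _)
            (≤-respʳ-≈ (+-comm _ _) (+-monoˡ-≤ (u x₀) d≤)))))
          (inv≤ 0<ux 0<u (≤-trans (∣x-y∣≤⇒x≤y+ q) (≤-respˡ-≈ (+-comm _ _)
            (≤-respʳ-≈ (trans (+-comm _ _) (+-congˡ (swap ε (u x₀) (u x)))) (+-monoˡ-≤ (u x) d≤))))))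
      -- The first bound keeps `u x` at least `h`, half of `u x₀`. The second then makes the
      -- difference at most `ε * u x₀ * u x`, which is `ε` after division by both values.
      (cu h 0<h) (cu (ε * u x₀ * h) (0<* (0<* 0<ε 0<u) 0<h))
      where
      h : ℝ
      h = ½ * u x₀
      0<h : 0# < h
      0<h = 0<* 0<½ 0<u
      half : ∀ y → h + (y + h - u x₀) ≈ y
      half y = trans (+-congˡ (+-congˡ (-‿cong (sym (½*x+½*x≈x (u x₀))))))
        (solve 2 (λ h y → h :+ (y :+ h :- (h :+ h)) := y) refl h y)
      swap : ∀ a b c → a * b * c ≈ a * c * b
      swap = solve 3 (λ a b c → a :* b :* c := a :* c :* b) refl
      inv≤ : ∀ {a b} → 0# < a → 0# < b → b ≤ a + ε * a * b → inv a ≤ inv b + ε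
      inv≤ {a} {b} 0<a 0<b b≤ = *-cancelˡ-≤ (0<* 0<a 0<b) (≤-respˡ-≈ (sym lhs) (≤-respʳ-≈ (sym rhs) b≤))
        where
        lhs : a * b * inv a ≈ b
        lhs = trans (solve 3 (λ a b i → a :* b :* i := a :* i :* b) refl a b (inv a))
          (trans (*-congʳ (*-inv (0<⇒≉0 0<a))) (*-identityˡ b))
        rhs : a * b * (inv b + ε) ≈ a + ε * a * b
        rhs = trans (solve 4 (λ a b i e → a :* b :* (i :+ e) := b :* i :* a :+ e :* a :* b) refl a b (inv b) ε)
          (+-congʳ (trans (*-congʳ (*-inv (0<⇒≉0 0<b))) (*-identityˡ a)))

    continuous-sum : ∀ {n} {u : Point X → Vector ℝ n} →
                     (∀ i → Continuous (λ x → u x i)) → Continuous (λ x → sum (u x))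
    continuous-sum {ℕ.zero}  cu = continuous-const 0#
    continuous-sum {ℕ.suc n} cu = continuous-+ (cu zero) (continuous-sum (λ i → cu (suc i)))

  -- Continuity already gives the congruence law: images of points at distance 0
  -- are within every h > 0 of each other.
  continuousMap : ∀ {X Y} (f : Point X → Point Y) → (∀ x → Pointwise.ContinuousTo X x Y f) →
                  ContinuousMap X Y
  continuousMap {X} {Y} f cf = record
    { to         = f
    ; cong       = λ {x} {x′} x≋x′ → Y.0⇒≈ (antisym
        (≤-limit 1# 0≤1 λ h 0<h _ → let δ , 0<δ , near = cf x h 0<h in
          ≤-respʳ-≈ (sym (trans (+-identityˡ _) (*-identityʳ h)))
            (near x′ (≤-<-trans (≤-reflexive (X.≈⇒0 x≋x′)) 0<δ)))
        Y.nonNegative)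
    ; continuous = λ x ε 0<ε → let δ , 0<δ , near = cf x (½ * ε) (0<* 0<½ 0<ε) in
        δ , 0<δ , λ x′ d → ≤-<-trans (near x′ d) (½*x<x 0<ε)
    }
    where
    module X = MetricSpace X
    module Y = MetricSpace Y

  -- Rescaling complex numbers to a prescribed modulus.

  0≤∣_∣² : ∀ z → 0# ≤ ∣ z ∣²
  0≤∣ x , y ∣² = 0≤+ (0≤x² x) (0≤x² y)

  x+y≈0⇒x≈0 : ∀ {x y} → 0# ≤ x → 0# ≤ y → x + y ≈ 0# → x ≈ 0#
  x+y≈0⇒x≈0 {x} 0≤x 0≤y x+y≈0 = antisym (≤-respʳ-≈ x+y≈0 (x≤x+y x 0≤y)) 0≤x

  ∣z∣²≈0⇒z≈0 : ∀ {x y} → ∣ x , y ∣² ≈ 0# → x ≈ 0# × y ≈ 0#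
  ∣z∣²≈0⇒z≈0 {x} {y} h =
    x*x≈0⇒x≈0 (x+y≈0⇒x≈0 (0≤x² x) (0≤x² y) h) ,
    x*x≈0⇒x≈0 (x+y≈0⇒x≈0 (0≤x² y) (0≤x² x) (trans (+-comm (y * y) (x * x)) h))

  infix 4 _≈ᶜ_
  _≈ᶜ_ : ℂ → ℂ → Set
  _≈ᶜ_ = MetricSpace._≋_ complexLine

  _·_ : ℝ → ℂ → ℂ
  k · (x , y) = k * x , k * y

  ∣k·z∣² : ∀ k z → ∣ k · z ∣² ≈ k * k * ∣ z ∣²
  ∣k·z∣² k (x , y) = solve 3 (λ k x y → k :* x :* (k :* x) :+ k :* y :* (k :* y)
    := k :* k :* (x :* x :+ y :* y)) refl k x y

  factor : ℂ → ℝ → ℝ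
  factor z s = √ (s * inv ∣ z ∣²)

  -- The complex number of squared modulus s with the argument of z; it is 0 if
  -- z is 0, so s ≈ 0 is then required for the modulus to be right.
  rescale : ℂ → ℝ → ℂ
  rescale z s = factor z s · z

  factor²*∣z∣² : ∀ z {s} → 0# ≤ s → (∣ z ∣² ≈ 0# → s ≈ 0#) → factor z s * factor z s * ∣ z ∣² ≈ s
  factor²*∣z∣² z {s} 0≤s s≈0 with em {∣ z ∣² ≈ 0#}
  ... | yes r≈0 = trans (*-congˡ r≈0) (trans (zeroʳ _) (sym (s≈0 r≈0)))
  ... | no r≉0  = trans (*-congʳ (√*√ (*-nonneg 0≤s (0≤inv 0≤∣ z ∣²))))
    (trans (solve 3 (λ s i r → s :* i :* r := s :* (r :* i)) refl s (inv ∣ z ∣²) ∣ z ∣²)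
      (trans (*-congˡ (*-inv r≉0)) (*-identityʳ s)))

  ∣rescale∣² : ∀ z {s} → 0# ≤ s → (∣ z ∣² ≈ 0# → s ≈ 0#) → ∣ rescale z s ∣² ≈ s
  ∣rescale∣² z 0≤s s≈0 = trans (∣k·z∣² _ z) (factor²*∣z∣² z 0≤s s≈0)

  -- If `z` vanishes, so do both sides; otherwise `k` and `factor z s` are nonnegative with the same
  -- square.
  rescale-unique : ∀ {k} z {s} → 0# ≤ k → k * k * ∣ z ∣² ≈ s → k · z ≈ᶜ rescale z s
  rescale-unique {k} z {s} 0≤k k²r≈s with em {∣ z ∣² ≈ 0#}
  ... | yes r≈0 = zero-product (proj₁ (∣z∣²≈0⇒z≈0 r≈0)) , zero-product (proj₂ (∣z∣²≈0⇒z≈0 r≈0))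
    where
    zero-product : ∀ {x l} → x ≈ 0# → k * x ≈ l * x
    zero-product x≈0 = trans (trans (*-congˡ x≈0) (zeroʳ k)) (sym (trans (*-congˡ x≈0) (zeroʳ _)))
  ... | no r≉0 = *-congʳ k≈ , *-congʳ k≈
    where
    k²≈s/r : k * k ≈ s * inv ∣ z ∣²
    k²≈s/r = sym (trans (*-congʳ (sym k²r≈s))
      (trans (*-assoc _ _ _) (trans (*-congˡ (*-inv r≉0)) (*-identityʳ _))))
    0≤s/r : 0# ≤ s * inv ∣ z ∣²
    0≤s/r = ≤-respʳ-≈ k²≈s/r (0≤x² k)
    k≈ : k ≈ factor z s
    k≈ = square-cancel 0≤k (0≤√ _) (trans k²≈s/r (sym (√*√ 0≤s/r)))

  rescale-∣z∣² : ∀ z {s} → s ≈ ∣ z ∣² → rescale z s ≈ᶜ z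
  rescale-∣z∣² z {s} s≈r =
    trans (sym (proj₁ unique)) (*-identityˡ _) , trans (sym (proj₂ unique)) (*-identityˡ _)
    where
    unique : 1# · z ≈ᶜ rescale z s
    unique = rescale-unique z 0≤1 (trans (*-congʳ (*-identityˡ 1#)) (trans (*-identityˡ _) (sym s≈r)))

  -- The product of the two factors is nonnegative and leads from `∣ z ∣²` to `s`, so uniqueness
  -- applies. The separate `t` admits ends of segments, which are known only up to `≈`.
  rescale-rescale : ∀ z {r s t} → 0# ≤ r → 0# ≤ s → (∣ z ∣² ≈ 0# → r ≈ 0#) → (r ≈ 0# → s ≈ 0#) →
                    t ≈ s → rescale z t ≈ᶜ rescale (rescale z r) s
  rescale-rescale z {r} {s} {t} 0≤r 0≤s r≈0 s≈0 t≈s =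
    trans (sym (proj₁ unique)) (*-assoc l k (proj₁ z)) , trans (sym (proj₂ unique)) (*-assoc l k (proj₂ z))
    where
    k l : ℝ
    k = factor z r
    l = factor (rescale z r) s
    ∣w∣²≈r = ∣rescale∣² z 0≤r r≈0
    unique : (l * k) · z ≈ᶜ rescale z t
    unique = rescale-unique z (*-nonneg (0≤√ _) (0≤√ _)) (begin
      l * k * (l * k) * ∣ z ∣²     ≈⟨ regroup l k ∣ z ∣² ⟩
      l * l * (k * k * ∣ z ∣²)     ≈⟨ *-congˡ (∣k·z∣² k z) ⟨
      l * l * ∣ rescale z r ∣²     ≈⟨ factor²*∣z∣² (rescale z r) 0≤s (λ w≈0 → s≈0 (trans (sym ∣w∣²≈r) w≈0)) ⟩
      s                            ≈⟨ t≈s ⟨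
      t                            ∎)
      where
      open ≈-Reasoning
      regroup : ∀ l k r → l * k * (l * k) * r ≈ l * l * (k * k * r)
      regroup = solve 3 (λ l k r → l :* k :* (l :* k) :* r := l :* l :* (k :* k :* r)) refl

  module _ (X : MetricSpace) (x₀ : Point X) where
    open Pointwise X x₀

    continuous-∣∣² : {z : Point X → ℂ} → Continuous (λ x → proj₁ (z x)) → Continuous (λ x → proj₂ (z x)) →
                     Continuous (λ x → ∣ z x ∣²)
    continuous-∣∣² cx cy = continuous-+ (continuous-* cx cx) (continuous-* cy cy)

    module _ {z : Point X → ℂ} {s : Point X → ℝ} (0≤s : ∀ x → 0# ≤ s x)
             (s≈0 : ∀ x → ∣ z x ∣² ≈ 0# → s x ≈ 0#)
             (cz : Continuous (λ x → ∣ z x ∣²)) (cs : Continuous s) where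

      -- Where z vanishes the factor may be unbounded nearby; there (k c)² ≤ k² ∣ z ∣² ≈ s.
      continuous-factor* : ∀ {c : Point X → ℝ} → (∀ x → c x * c x ≤ ∣ z x ∣²) → Continuous c →
                           Continuous (λ x → factor (z x) (s x) * c x)
      continuous-factor* {c} c²≤r cc with em {∣ z x₀ ∣² ≈ 0#}
      ... | no r≉0 = continuous-* (continuous-√ (λ x → *-nonneg (0≤s x) (0≤inv 0≤∣ z x ∣²))
              (continuous-* cs (continuous-inv (≉0⇒0< 0≤∣ z x₀ ∣² r≉0) cz))) cc
      ... | yes r≈0 = λ ε 0<ε → near-map (λ x p → bound 0<ε (small x (∣x-y∣≤⇒y≤x+ p)))
                                         (cs (ε * ε) (0<* 0<ε 0<ε))
        where
        w : Point X → ℝ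
        w x = factor (z x) (s x) * c x
        w²≤s : ∀ x → w x * w x ≤ s x
        w²≤s x = ≤-respˡ-≈ (regroup (factor (z x) (s x)) (c x)) (≤-respʳ-≈ (factor²*∣z∣² (z x) (0≤s x) (s≈0 x))
          (*-monoˡ-≤ (0≤x² _) (c²≤r x)))
          where
          regroup : ∀ k c → k * k * (c * c) ≈ k * c * (k * c)
          regroup = solve 2 (λ k c → k :* k :* (c :* c) := k :* c :* (k :* c)) refl
        small : ∀ {ε} x → s x ≤ s x₀ + ε → w x * w x ≤ ε
        small x s≤ = ≤-trans (w²≤s x) (≤-respʳ-≈ (trans (+-congʳ (s≈0 x₀ r≈0)) (+-identityˡ _)) s≤)
        w₀≈0 : w x₀ ≈ 0#
        w₀≈0 = x*x≈0⇒x≈0 (antisym (≤-respʳ-≈ (s≈0 x₀ r≈0) (w²≤s x₀)) (0≤x² _))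
        bound : ∀ {ε y} → 0# < ε → y * y ≤ ε * ε → ∣ w x₀ - y ∣ ≤ ε
        bound {ε} {y} 0<ε y²≤ε² = ≤-respˡ-≈
          (trans (sym (∣-x∣≈∣x∣ y)) (∣∣-cong (trans (sym (+-identityˡ (- y))) (+-congʳ (sym w₀≈0)))))
          (∣∣≤ (square-cancel-≤ (proj₁ 0<ε) y²≤ε²)
               (square-cancel-≤ (proj₁ 0<ε) (≤-respˡ-≈ (solve 1 (λ y → y :* y := :- y :* :- y) refl y) y²≤ε²)))

      continuous-rescale : Continuous (λ x → proj₁ (z x)) → Continuous (λ x → proj₂ (z x)) →
                           ContinuousTo complexLine (λ x → rescale (z x) (s x))
      continuous-rescale cx cy = continuous-into-⊗ {line} {line}
        (continuous-factor* (λ x → x≤x+y _ (0≤x² _)) cx)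
        (continuous-factor* (λ x → ≤-respʳ-≈ (+-comm _ _) (x≤x+y _ (0≤x² _))) cy)

  -- Convex combinations and multilinear interpolation.

  lerp : ℝ → ℝ → ℝ → ℝ
  lerp s x y = (1# - s) * x + s * y

  lerp-const : ∀ s {x y c} → x ≈ c → y ≈ c → lerp s x y ≈ c
  lerp-const s {c = c} x≈c y≈c = trans (+-cong (*-congˡ x≈c) (*-congˡ y≈c))
    (solve 2 (λ s c → (con (+ 1) :- s) :* c :+ s :* c := c) refl s c)

  lerp-≈0 : ∀ {s} x y → s ≈ 0# → lerp s x y ≈ x
  lerp-≈0 {s} x y s≈0 = trans (+-cong (*-congʳ (+-congˡ (-‿cong s≈0))) (*-congʳ s≈0))
    (solve 2 (λ x y → (con (+ 1) :- con (+ 0)) :* x :+ con (+ 0) :* y := x) refl x y)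

  lerp-≈1 : ∀ {s} x y → s ≈ 1# → lerp s x y ≈ y
  lerp-≈1 {s} x y s≈1 = trans (+-cong (*-congʳ (+-congˡ (-‿cong s≈1))) (*-congʳ s≈1))
    (solve 2 (λ x y → (con (+ 1) :- con (+ 1)) :* x :+ con (+ 1) :* y := y) refl x y)

  lerp-mono-≤ : ∀ {s x x′ y y′} → 0# ≤ s → s ≤ 1# → x ≤ x′ → y ≤ y′ → lerp s x y ≤ lerp s x′ y′
  lerp-mono-≤ 0≤s s≤1 x≤x′ y≤y′ =
    +-mono-≤ (*-monoˡ-≤ (0≤y-x s≤1) x≤x′) (*-monoˡ-≤ 0≤s y≤y′)

  lerp-≥ : ∀ {s x y c} → 0# ≤ s → s ≤ 1# → c ≤ x → c ≤ y → c ≤ lerp s x y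
  lerp-≥ {s} 0≤s s≤1 c≤x c≤y = ≤-respˡ-≈ (lerp-const s refl refl) (lerp-mono-≤ 0≤s s≤1 c≤x c≤y)

  lerp-≤ : ∀ {s x y c} → 0# ≤ s → s ≤ 1# → x ≤ c → y ≤ c → lerp s x y ≤ c
  lerp-≤ {s} 0≤s s≤1 x≤c y≤c = ≤-respʳ-≈ (lerp-const s refl refl) (lerp-mono-≤ 0≤s s≤1 x≤c y≤c)

  -- Both weights are positive and both values nonnegative, so nothing can cancel.
  lerp-½≈0 : ∀ {x y} → 0# ≤ x → 0# ≤ y → lerp ½ x y ≈ 0# → x ≈ 0# × y ≈ 0#
  lerp-½≈0 {x} {y} 0≤x 0≤y h =
    x*y≈0⇒y≈0 (0<⇒≉0 0<1-½) (x+y≈0⇒x≈0 0≤[1-½]x 0≤½y h) ,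
    x*y≈0⇒y≈0 (0<⇒≉0 0<½) (x+y≈0⇒x≈0 0≤½y 0≤[1-½]x (trans (+-comm _ _) h))
    where
    0<1-½ : 0# < 1# - ½
    0<1-½ = <-≤-trans 0<½ (≤-reflexive (trans (solve 1 (λ h → h := h :+ h :- h) refl ½) (+-congʳ ½+½≈1)))
    0≤[1-½]x = *-nonneg (proj₁ 0<1-½) 0≤x
    0≤½y = *-nonneg (proj₁ 0<½) 0≤y

  lerpᵛ : ∀ {n} → ℝ → Vector ℝ n → Vector ℝ n → Vector ℝ n
  lerpᵛ s x y k = lerp s (x k) (y k)

  ⟨,⟩-cong : ∀ {n} (a : Vector ℝ n) {x y} → (∀ k → x k ≈ y k) → ⟨ a , x ⟩ ≈ ⟨ a , y ⟩
  ⟨,⟩-cong {ℕ.zero}  a x≈y = refl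
  ⟨,⟩-cong {ℕ.suc n} a x≈y = +-cong (*-congˡ (x≈y zero)) (⟨,⟩-cong (λ k → a (suc k)) (λ k → x≈y (suc k)))

  ⟨,⟩-lerp : ∀ {n} s (a x y : Vector ℝ n) → ⟨ a , lerpᵛ s x y ⟩ ≈ lerp s ⟨ a , x ⟩ ⟨ a , y ⟩
  ⟨,⟩-lerp {ℕ.zero}  s a x y = sym (lerp-const s refl refl)
  ⟨,⟩-lerp {ℕ.suc n} s a x y = trans
    (+-congˡ (⟨,⟩-lerp s (λ k → a (suc k)) (λ k → x (suc k)) (λ k → y (suc k))))
    (solve 6 (λ s a x y p q → a :* ((con (+ 1) :- s) :* x :+ s :* y) :+ ((con (+ 1) :- s) :* p :+ s :* q)
      := (con (+ 1) :- s) :* (a :* x :+ p) :+ s :* (a :* y :+ q)) refl s (a zero) (x zero) (y zero) _ _)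

  -- Multilinear interpolation of values at the vertices of the cube [0,1]ᵐ; the
  -- vertex of σ has coordinate 0 at the elements of σ and 1 elsewhere.
  interpolate : ∀ {n m} → Vector ℝ m → (Subset m → Vector ℝ n) → Vector ℝ n
  interpolate {m = ℕ.zero}  t v = v []
  interpolate {m = ℕ.suc m} t v = lerpᵛ (t zero)
    (interpolate (λ i → t (suc i)) (λ σ → v (inside ∷ σ)))
    (interpolate (λ i → t (suc i)) (λ σ → v (outside ∷ σ)))

  -- The weight of `σ` in the interpolation is the product of `1# - t i` over `σ` and of `t i` off
  -- `σ`; here none of these factors vanishes.
  Active : ∀ {m} → Vector ℝ m → Subset m → Set
  Active t σ = ∀ i → (lookup σ i ≡ inside → t i ≉ 1#) × (lookup σ i ≡ outside → t i ≉ 0#)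

  module _ {n} (C : Vector ℝ n → Set)
           (resp : ∀ {x y} → (∀ k → x k ≈ y k) → C x → C y)
           (convex : ∀ {s x y} → 0# ≤ s → s ≤ 1# → C x → C y → C (lerpᵛ s x y)) where

    -- Induction on coordinates: when the first one is 0 or 1, only one half of the cube
    -- contributes, and nothing is asked of the values on the other half.
    interpolate-∈ : ∀ {m} (t : Vector ℝ m) → (∀ i → 0# ≤ t i × t i ≤ 1#) →
                    (v : Subset m → Vector ℝ n) → (∀ σ → Active t σ → C (v σ)) → C (interpolate t v)
    interpolate-∈ {ℕ.zero}  t 0≤t≤1 v v∈C = v∈C [] (λ ())
    interpolate-∈ {ℕ.suc m} t 0≤t≤1 v v∈C with em {t zero ≈ 0#} | em {t zero ≈ 1#}
    ... | yes t₀≈0 | yes t₀≈1 = contradiction (trans (sym t₀≈1) t₀≈0) 1≉0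
    ... | yes t₀≈0 | no t₀≉1  = resp (λ k → sym (lerp-≈0 _ _ t₀≈0))
      (interpolate-∈ _ (λ i → 0≤t≤1 (suc i)) _ (λ σ act → v∈C (inside ∷ σ)
        λ { zero → (λ _ → t₀≉1) , λ () ; (suc i) → act i }))
    ... | no t₀≉0  | yes t₀≈1 = resp (λ k → sym (lerp-≈1 _ _ t₀≈1))
      (interpolate-∈ _ (λ i → 0≤t≤1 (suc i)) _ (λ σ act → v∈C (outside ∷ σ)
        λ { zero → (λ ()) , (λ _ → t₀≉0) ; (suc i) → act i }))
    ... | no t₀≉0  | no t₀≉1  = convex (proj₁ (0≤t≤1 zero)) (proj₂ (0≤t≤1 zero))
      (interpolate-∈ _ (λ i → 0≤t≤1 (suc i)) _ (λ σ act → v∈C (inside ∷ σ)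
        λ { zero → (λ _ → t₀≉1) , (λ ()) ; (suc i) → act i }))
      (interpolate-∈ _ (λ i → 0≤t≤1 (suc i)) _ (λ σ act → v∈C (outside ∷ σ)
        λ { zero → (λ ()) , (λ _ → t₀≉0) ; (suc i) → act i }))

  -- Finite maxima, minima and gaps above zero.

  max-subset : ∀ {m} → (Subset m → ℝ) → ℝ
  max-subset {ℕ.zero}  u = u []
  max-subset {ℕ.suc m} u = max-subset (λ σ → u (inside ∷ σ)) ⊔ max-subset (λ σ → u (outside ∷ σ))

  u≤max-subset : ∀ {m} (u : Subset m → ℝ) σ → u σ ≤ max-subset u
  u≤max-subset u []            = ≤-refl
  u≤max-subset u (inside ∷ σ)  = ≤-trans (u≤max-subset (λ σ → u (inside ∷ σ)) σ) (x≤x⊔y _ _)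
  u≤max-subset u (outside ∷ σ) = ≤-trans (u≤max-subset (λ σ → u (outside ∷ σ)) σ) (x≤y⊔x _ _)

  max-subset-attained : ∀ {m} (u : Subset m → ℝ) → ∃[ σ ] max-subset u ≈ u σ
  max-subset-attained {ℕ.zero}  u = [] , refl
  max-subset-attained {ℕ.suc m} u
    with ⊔-sel (max-subset (λ σ → u (inside ∷ σ))) (max-subset (λ σ → u (outside ∷ σ)))
  ... | inj₁ eq = let σ , p = max-subset-attained (λ σ → u (inside ∷ σ)) in inside ∷ σ , trans eq p
  ... | inj₂ eq = let σ , p = max-subset-attained (λ σ → u (outside ∷ σ)) in outside ∷ σ , trans eq p

  min : ∀ {m} → ℝ → Vector ℝ m → ℝ
  min e = foldr _⊓_ e

  min≤ : ∀ {m} e (u : Vector ℝ m) → min e u ≤ e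
  min≤ {ℕ.zero}  e u = ≤-refl
  min≤ {ℕ.suc m} e u = ≤-trans (x⊓y≤y _ _) (min≤ e (λ i → u (suc i)))

  min≤u : ∀ {m} e (u : Vector ℝ m) i → min e u ≤ u i
  min≤u e u zero    = x⊓y≤x _ _
  min≤u e u (suc i) = ≤-trans (x⊓y≤y _ _) (min≤u e (λ i → u (suc i)) i)

  0<min : ∀ {m e} (u : Vector ℝ m) → 0# < e → (∀ i → 0# < u i) → 0# < min e u
  0<min {ℕ.zero}  u 0<e 0<u = 0<e
  0<min {ℕ.suc m} u 0<e 0<u = 0<⊓ (0<u zero) (0<min (λ i → u (suc i)) 0<e (λ i → 0<u (suc i)))

  -- Zero entries are replaced by 1 before the minimum is taken, so it is positive and still bounds
  -- the nonzero entries from below.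
  gap-∀ : ∀ {m} (u : Vector ℝ m) → (∀ i → 0# ≤ u i) → ∃[ η ] 0# < η × (∀ i → u i ≈ 0# ⊎ η ≤ u i)
  gap-∀ u 0≤u = min 1# w , 0<min w 0<1 0<w , λ i → below i (min≤u 1# w i)
    where
    w : Vector ℝ _
    w i with em {u i ≈ 0#}
    ... | yes _ = 1#
    ... | no _  = u i
    0<w : ∀ i → 0# < w i
    0<w i with em {u i ≈ 0#}
    ... | yes _  = 0<1
    ... | no u≉0 = ≉0⇒0< (0≤u i) u≉0
    below : ∀ i {e} → e ≤ w i → u i ≈ 0# ⊎ e ≤ u i
    below i e≤w with em {u i ≈ 0#}
    ... | yes u≈0 = inj₁ u≈0
    ... | no _    = inj₂ e≤w

  gap-∀-subset : ∀ {k m} (u : Subset k → Vector ℝ m) → (∀ σ i → 0# ≤ u σ i) →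
                 ∃[ η ] 0# < η × (∀ σ i → u σ i ≈ 0# ⊎ η ≤ u σ i)
  gap-∀-subset {ℕ.zero} u 0≤u =
    let η , 0<η , gap = gap-∀ (u []) (0≤u []) in η , 0<η , λ { [] → gap }
  gap-∀-subset {ℕ.suc k} u 0≤u
    with gap-∀-subset (λ σ → u (inside ∷ σ)) (λ σ → 0≤u (inside ∷ σ))
       | gap-∀-subset (λ σ → u (outside ∷ σ)) (λ σ → 0≤u (outside ∷ σ))
  ... | η , 0<η , gap | η′ , 0<η′ , gap′ = η ⊓ η′ , 0<⊓ 0<η 0<η′ , λ where
    (inside ∷ σ) i  → Sum.map₂ (≤-trans (x⊓y≤x η η′)) (gap σ i)
    (outside ∷ σ) i → Sum.map₂ (≤-trans (x⊓y≤y η η′)) (gap′ σ i)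

  -- Continuity of interpolation, finite extrema and slacks.

  module _ (X : MetricSpace) (x₀ : Point X) where
    open Pointwise X x₀

    continuous-lerp : ∀ {s u v} → Continuous s → Continuous u → Continuous v →
                      Continuous (λ x → lerp (s x) (u x) (v x))
    continuous-lerp {s} cs cu cv = continuous-+
      (continuous-* (continuous-+ (continuous-const 1#) (continuous-neg cs)) cu) (continuous-* cs cv)

    continuous-interpolate : ∀ {n m} {t : Point X → Vector ℝ m} (v : Subset m → Vector ℝ n) k →
                             (∀ i → Continuous (λ x → t x i)) →
                             Continuous (λ x → interpolate (t x) v k)
    continuous-interpolate {m = ℕ.zero}  v k ct = continuous-const (v [] k)
    continuous-interpolate {m = ℕ.suc m} v k ct = continuous-lerp (ct zero)
      (continuous-interpolate (λ σ → v (inside ∷ σ)) k (λ i → ct (suc i)))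
      (continuous-interpolate (λ σ → v (outside ∷ σ)) k (λ i → ct (suc i)))

    continuous-max-subset : ∀ {m} {u : Point X → Subset m → ℝ} →
                            (∀ σ → Continuous (λ x → u x σ)) → Continuous (λ x → max-subset (u x))
    continuous-max-subset {ℕ.zero}  cu = cu []
    continuous-max-subset {ℕ.suc m} cu = continuous-⊔
      (continuous-max-subset (λ σ → cu (inside ∷ σ))) (continuous-max-subset (λ σ → cu (outside ∷ σ)))

    continuous-min : ∀ {m} e {u : Point X → Vector ℝ m} →
                     (∀ i → Continuous (λ x → u x i)) → Continuous (λ x → min e (u x))
    continuous-min {ℕ.zero}  e cu = continuous-const e
    continuous-min {ℕ.suc m} e cu = continuous-⊓ (cu zero) (continuous-min e (λ i → cu (suc i)))

    continuous-slack : ∀ {n m} (a : Vector (Vector ℝ n) m) b {u : Point X → Vector ℝ n} →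
                       (∀ k → Continuous (λ x → u x k)) → ∀ i → Continuous (λ x → slack a b (u x) i)
    continuous-slack a b cu i = continuous-+
      (continuous-sum (λ k → continuous-* (continuous-const (a i k)) (cu k))) (continuous-const (b i))

  -- Faces of the polytope and the maps between the bases.

  module Faces {n m} (a : Vector (Vector ℝ n) m) (b : Vector ℝ m)
               (p₀ : Vector ℝ n) (p₀∈P : Polyhedron a b p₀) where

    ℓ : Vector ℝ n → Vector ℝ m
    ℓ = slack a b

    P : Vector ℝ n → Set
    P = Polyhedron a b

    ℓ-cong : ∀ {x y} → (∀ k → x k ≈ y k) → ∀ i → ℓ x i ≈ ℓ y i
    ℓ-cong x≈y i = +-congʳ (⟨,⟩-cong (a i) x≈y)

    ℓ-lerp : ∀ s x y i → ℓ (lerpᵛ s x y) i ≈ lerp s (ℓ x i) (ℓ y i)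
    ℓ-lerp s x y i = trans (+-congʳ (⟨,⟩-lerp s (a i) x y))
      (solve 4 (λ s p q b → ((con (+ 1) :- s) :* p :+ s :* q) :+ b
        := (con (+ 1) :- s) :* (p :+ b) :+ s :* (q :+ b)) refl s _ _ (b i))

    P-lerp : ∀ {s x y} → 0# ≤ s → s ≤ 1# → P x → P y → P (lerpᵛ s x y)
    P-lerp {s} {x} {y} 0≤s s≤1 x∈P y∈P i =
      ≤-respʳ-≈ (sym (ℓ-lerp s x y i)) (lerp-≥ 0≤s s≤1 (x∈P i) (y∈P i))

    Face : Subset m → Vector ℝ n → Set
    Face σ x = P x × (∀ i → lookup σ i ≡ inside → ℓ x i ≈ 0#)

    -- Required of a point of the face for every `i`, this places the point in the relative
    -- interior.
    Generic : Subset m → Vector ℝ n → Fin m → Set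
    Generic σ x i = ℓ x i ≈ 0# → ∀ y → Face σ y → ℓ y i ≈ 0#

    -- Averaging with a point of the face off the i-th wall leaves that wall and
    -- returns to no wall left before.
    generic-on : ∀ {k} σ → ∃ (Face σ) → (f : Fin k → Fin m) →
                 ∃[ x ] Face σ x × (∀ j → Generic σ x (f j))
    generic-on {ℕ.zero}  σ (x , x∈F) f = x , x∈F , λ ()
    generic-on {ℕ.suc k} σ nonempty f
      with generic-on σ nonempty (λ j → f (suc j)) | em {∃[ y ] Face σ y × ℓ y (f zero) ≉ 0#}
    ... | x , x∈F , generic | no none = x , x∈F , λ where
      zero _ y y∈F → decidable-stable em (λ ℓy≉0 → none (y , y∈F , ℓy≉0))
      (suc j)      → generic j
    ... | x , (x∈P , x∈F) , generic | yes (y , (y∈P , y∈F) , ℓy≉0) =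
      lerpᵛ ½ x y , (P-lerp (proj₁ 0<½) ½≤1 x∈P y∈P ,
        λ i i∈σ → trans (ℓ-lerp ½ x y i) (lerp-const ½ (x∈F i i∈σ) (y∈F i i∈σ))) , λ where
          zero h    → contradiction (proj₂ (both h)) ℓy≉0
          (suc j) h → generic j (proj₁ (both h))
      where
      ½≤1 : ½ ≤ 1#
      ½≤1 = ≤-by ½ (proj₁ 0<½) ½+½≈1
      both : ∀ {i} → ℓ (lerpᵛ ½ x y) i ≈ 0# → ℓ x i ≈ 0# × ℓ y i ≈ 0#
      both {i} h = lerp-½≈0 (x∈P i) (y∈P i) (trans (sym (ℓ-lerp ½ x y i)) h)

    abstract
      -- The value assigned to a vertex of the cube, in general no vertex of the polytope. The
      -- default `p₀` keeps it in `P` when the face is empty; such `σ` are never active on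
      -- `CubicalCone`.
      vertex : Subset m → Vector ℝ n
      vertex σ with em {∃ (Face σ)}
      ... | yes nonempty = proj₁ (generic-on σ nonempty (λ i → i))
      ... | no _         = p₀

      vertex-∈P : ∀ σ → P (vertex σ)
      vertex-∈P σ with em {∃ (Face σ)}
      ... | yes nonempty = proj₁ (proj₁ (proj₂ (generic-on σ nonempty (λ i → i))))
      ... | no _         = p₀∈P

      vertex-∈Face : ∀ {σ y} → Face σ y → Face σ (vertex σ)
      vertex-∈Face {σ} y∈F with em {∃ (Face σ)}
      ... | yes nonempty = proj₁ (proj₂ (generic-on σ nonempty (λ i → i)))
      ... | no empty     = contradiction (_ , y∈F) empty

      vertex-generic : ∀ {σ y} → Face σ y → ∀ i → ℓ (vertex σ) i ≈ 0# → ℓ y i ≈ 0#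
      vertex-generic {σ} {y} y∈F i h with em {∃ (Face σ)}
      ... | yes nonempty = proj₂ (proj₂ (generic-on σ nonempty (λ i → i))) i h y y∈F
      ... | no empty     = contradiction (_ , y∈F) empty

      gap : ∃[ η ] 0# < η × (∀ σ i → ℓ (vertex σ) i ≈ 0# ⊎ η ≤ ℓ (vertex σ) i)
      gap = gap-∀-subset (λ σ → ℓ (vertex σ)) vertex-∈P

      η : ℝ
      η = proj₁ gap

      0<η : 0# < η
      0<η = proj₁ (proj₂ gap)

      vertex-gap : ∀ σ i → ℓ (vertex σ) i ≈ 0# ⊎ η ≤ ℓ (vertex σ) i
      vertex-gap = proj₂ (proj₂ gap)

    zeros : ∀ x → ∃[ σ ] ∀ i → (lookup σ i ≡ inside → ℓ x i ≈ 0#) × (lookup σ i ≡ outside → ℓ x i ≉ 0#)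
    zeros x = tabulate (λ i → does (em {ℓ x i ≈ 0#})) , λ i →
      (λ i∈ → true⇒ em (≡.trans (≡.sym (lookup∘tabulate _ i)) i∈)) ,
      (λ i∉ → false⇒ em (≡.trans (≡.sym (lookup∘tabulate _ i)) i∉))
      where
      true⇒ : {A : Set} (d : Dec A) → does d ≡ inside → A
      true⇒ (yes x) _ = x
      false⇒ : {A : Set} (d : Dec A) → does d ≡ outside → ¬ A
      false⇒ (no ¬x) _ = ¬x

    CommonPoint : Vector ℝ m → Vector ℝ n → Set
    CommonPoint t y = P y × (∀ i → ℓ y i ≈ 0# ⊎ t i ≈ 1#)

    -- The image of the moment-angle complex under r, with the simplex of z replaced
    -- by a point common to its walls.
    CubicalCone : Vector ℝ m → Set
    CubicalCone t = (∀ i → 0# ≤ t i × t i ≤ 1#) × ∃ (CommonPoint t)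

    ψ : Vector ℝ m → Vector ℝ n
    ψ t = interpolate t vertex

    module _ {t : Vector ℝ m} (0≤t≤1 : ∀ i → 0# ≤ t i × t i ≤ 1#) where

      ψ∈P : P (ψ t)
      ψ∈P = interpolate-∈ P (λ x≈y x∈P i → ≤-respʳ-≈ (ℓ-cong x≈y i) (x∈P i)) P-lerp
        t 0≤t≤1 vertex (λ σ _ → vertex-∈P σ)

      module _ {y} (y∈ : CommonPoint t y) where

        active⇒Face : ∀ σ → Active t σ → Face σ y
        active⇒Face σ act = proj₁ y∈ , λ i i∈σ →
          [ (λ ℓ≈0 → ℓ≈0) , (λ t≈1 → contradiction t≈1 (proj₁ (act i) i∈σ)) ]′ (proj₂ y∈ i)

        -- Vanishing of `t i` puts `i` into every active `σ`, and the chosen point of such a `σ`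
        -- lies in its face, which contains `y`.
        ψ-wall : ∀ {i} → t i ≈ 0# → ℓ (ψ t) i ≈ 0#
        ψ-wall {i} t≈0 = interpolate-∈ (λ x → ℓ x i ≈ 0#)
          (λ x≈y h → trans (sym (ℓ-cong x≈y i)) h)
          (λ {s} {x} {y} _ _ p q → trans (ℓ-lerp s x y i) (lerp-const s p q))
          t 0≤t≤1 vertex (λ σ act → proj₂ (vertex-∈Face (active⇒Face σ act)) i (∈σ σ act))
          where
          ∈σ : ∀ σ → Active t σ → lookup σ i ≡ inside
          ∈σ σ act with lookup σ i | act i
          ... | inside  | _ = ≡.refl
          ... | outside | h = contradiction t≈0 (proj₂ h ≡.refl)

        -- The point `y` lies in the face of every active `σ`, so by genericity the chosen points of
        -- these faces are off the wall too, hence at slack at least `η`; convexity does the rest.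
        ψ-gap : ∀ {i} → ℓ y i ≉ 0# → η ≤ ℓ (ψ t) i
        ψ-gap {i} ℓy≉0 = interpolate-∈ (λ x → η ≤ ℓ x i)
          (λ x≈y h → ≤-respʳ-≈ (ℓ-cong x≈y i) h)
          (λ {s} {x} {y} 0≤s s≤1 p q → ≤-respʳ-≈ (sym (ℓ-lerp s x y i)) (lerp-≥ 0≤s s≤1 p q))
          t 0≤t≤1 vertex (λ σ act →
            [ (λ h → contradiction (vertex-generic (active⇒Face σ act) i h) ℓy≉0) , (λ h → h) ]′ (vertex-gap σ i))

    -- The minimum is meant to run off `σ` only: since it is capped by `η` anyway, entries `η` in
    -- place of those in `σ` have no effect.
    margin : Subset m → Vector ℝ m → ℝ
    margin σ s = min η (λ i → if lookup σ i then η else s i)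

    margin≤ : ∀ σ s {i} → lookup σ i ≡ outside → margin σ s ≤ s i
    margin≤ σ s {i} i∉σ = ≡.subst (λ c → margin σ s ≤ (if c then η else s i)) i∉σ
      (min≤u η (λ i → if lookup σ i then η else s i) i)

    -- Passing the decision as an argument lets later proofs match on it. The value 0 for empty
    -- faces never attains the threshold of a point of `P`, which is positive.
    if-nonempty : {A : Set} → Dec A → ℝ → ℝ
    if-nonempty (yes _) r = r
    if-nonempty (no _)  _ = 0#

    -- For x in P the walls with slack < threshold (ℓ x) at x have a common point.
    threshold : Vector ℝ m → ℝ
    threshold s = max-subset (λ σ → if-nonempty (em {∃ (Face σ)}) (margin σ s))

    threshold≤η : ∀ s → threshold s ≤ η
    threshold≤η s with max-subset-attained (λ σ → if-nonempty (em {∃ (Face σ)}) (margin σ s))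
    ... | σ , eq = ≤-respˡ-≈ (sym eq) (bound em)
      where
      bound : {A : Set} (d : Dec A) → if-nonempty d (margin σ s) ≤ η
      bound (yes _) = min≤ η (λ i → if lookup σ i then η else s i)
      bound (no _)  = proj₁ 0<η

    -- Take for `σ` the walls through `x`: its face contains `x`, and every slack off `σ` is
    -- positive.
    0<threshold : ∀ {x} → P x → 0# < threshold (ℓ x)
    0<threshold {x} x∈P with zeros x
    ... | σ , σ-zeros = <-≤-trans (pos em)
            (u≤max-subset (λ σ → if-nonempty (em {∃ (Face σ)}) (margin σ (ℓ x))) σ)
      where
      0<weight : ∀ i c → lookup σ i ≡ c → 0# < (if c then η else ℓ x i)
      0<weight i inside  _   = 0<η
      0<weight i outside i∉σ = ≉0⇒0< (x∈P i) (proj₂ (σ-zeros i) i∉σ)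
      pos : (d : Dec (∃ (Face σ))) → 0# < if-nonempty d (margin σ (ℓ x))
      pos (yes _)    = 0<min (λ i → if lookup σ i then η else ℓ x i) 0<η (λ i → 0<weight i (lookup σ i) ≡.refl)
      pos (no empty) = contradiction (x , x∈P , λ i → proj₁ (σ-zeros i)) empty

    -- Being positive, the maximum is attained at a nonempty face. Any `y` in it will do, since the
    -- slacks of `x` off that `σ` are at least the margin.
    threshold-point : ∀ {x} → P x → ∃[ y ] P y × (∀ i → ℓ y i ≈ 0# ⊎ threshold (ℓ x) ≤ ℓ x i)
    threshold-point {x} x∈P with max-subset-attained (λ σ → if-nonempty (em {∃ (Face σ)}) (margin σ (ℓ x)))
    ... | σ , eq = point em eq
      where
      point : (d : Dec (∃ (Face σ))) → threshold (ℓ x) ≈ if-nonempty d (margin σ (ℓ x)) →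
              ∃[ y ] P y × (∀ i → ℓ y i ≈ 0# ⊎ threshold (ℓ x) ≤ ℓ x i)
      point (no _) eq = contradiction eq (0<⇒≉0 (0<threshold x∈P))
      point (yes (y , y∈P , y∈F)) eq = y , y∈P , λ i → wall-or-far i (lookup σ i) ≡.refl
        where
        wall-or-far : ∀ i c → lookup σ i ≡ c → ℓ y i ≈ 0# ⊎ threshold (ℓ x) ≤ ℓ x i
        wall-or-far i inside  i∈σ = inj₁ (y∈F i i∈σ)
        wall-or-far i outside i∉σ = inj₂ (≤-respˡ-≈ (sym eq) (margin≤ σ (ℓ x) i∉σ))

    φ : Vector ℝ n → Vector ℝ m
    φ x i = 1# ⊓ (ℓ x i * inv (threshold (ℓ x)))

    module _ {x} (x∈P : P x) where
      private
        0<E : 0# < threshold (ℓ x)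
        0<E = 0<threshold x∈P

      0≤φ≤1 : ∀ i → 0# ≤ φ x i × φ x i ≤ 1#
      0≤φ≤1 i = ⊓-glb 0≤1 (*-nonneg (x∈P i) (proj₁ (0<inv 0<E))) , x⊓y≤x _ _

      φ-wall : ∀ {i} → ℓ x i ≈ 0# → φ x i ≈ 0#
      φ-wall {i} h = antisym (≤-trans (x⊓y≤y _ _) (≤-reflexive (trans (*-congʳ h) (zeroˡ _)))) (proj₁ (0≤φ≤1 i))

      φ-far : ∀ {i} → threshold (ℓ x) ≤ ℓ x i → φ x i ≈ 1#
      φ-far {i} E≤ = antisym (x⊓y≤x _ _) (⊓-glb ≤-refl (≤-respˡ-≈ (*-inv (0<⇒≉0 0<E))
        (≤-respˡ-≈ (*-comm _ _) (≤-respʳ-≈ (*-comm _ _) (*-monoˡ-≤ (proj₁ (0<inv 0<E)) E≤)))))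

      φ∈CubicalCone : CubicalCone (φ x)
      φ∈CubicalCone = 0≤φ≤1 , let y , y∈P , h = threshold-point x∈P in
        y , y∈P , λ i → Sum.map₂ φ-far (h i)

    module _ (X : MetricSpace) (x₀ : Point X) where
      open Pointwise X x₀

      -- Which faces are empty does not depend on `x`, so the threshold is one fixed expression of
      -- finite extrema in the slacks; its positivity makes inversion continuous.
      continuous-φ : {u : Point X → Vector ℝ n} → (∀ x → P (u x)) → (∀ k → Continuous (λ x → u x k)) →
                     ∀ i → Continuous (λ x → φ (u x) i)
      continuous-φ {u} u∈P cu i = continuous-⊓ (continuous-const 1#) (continuous-* (cℓ i)
        (continuous-inv (0<threshold (u∈P x₀)) (continuous-max-subset X x₀ (λ σ → c-if σ em))))
        where
        cℓ : ∀ i → Continuous (λ x → ℓ (u x) i)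
        cℓ = continuous-slack X x₀ a b cu
        c-weight : ∀ i c → Continuous (λ x → if c then η else ℓ (u x) i)
        c-weight i inside  = continuous-const η
        c-weight i outside = cℓ i
        c-if : ∀ σ (d : Dec (∃ (Face σ))) → Continuous (λ x → if-nonempty d (margin σ (ℓ (u x))))
        c-if σ (yes _) = continuous-min X x₀ η (λ i → c-weight i (lookup σ i))
        c-if σ (no _)  = continuous-const 0#

  -- Lifting the maps to the moment-angle spaces.

  module Equivalence {n m} (Q : Polytope n m) where
    open Polytope Q using (a; b; fullDimensional)

    -- Full dimension supplies `n + 1` points of the polytope, hence at least one.
    p₀ : Vector ℝ n
    p₀ = proj₁ (proj₁ fullDimensional) zero

    p₀∈P : Polyhedron a b p₀
    p₀∈P = proj₁ (proj₂ (proj₁ fullDimensional)) zero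

    open Faces a b p₀ p₀∈P

    ZK ZP : MetricSpace
    ZK = momentAngleComplex (K Q)
    ZP = momentAngleSpace Q

    r : Vector ℂ m → Vector ℝ m
    r z i = ∣ z i ∣²

    cone : (z : Point ZK) → CubicalCone (r (proj₁ z))
    cone (z , α , α∈K , h) = (λ i → 0≤∣ z i ∣² , r≤1 i) , point em α∈K
      where
      outside⇒1 : ∀ i → lookup α i ≡ outside → r z i ≈ 1#
      outside⇒1 i i∉α = proj₂ (h i) λ i∈α → case ≡.trans (≡.sym i∉α) ([]=⇒lookup i∈α) of λ ()
      r≤1 : ∀ i → r z i ≤ 1#
      r≤1 i with lookup α i in eq
      ... | inside  = proj₁ (h i) (lookup⇒[]= i α eq)
      ... | outside = ≤-reflexive (outside⇒1 i eq)
      point : Dec (Nonempty α) → SimplicialComplex.Simplex (K Q) α → ∃ (CommonPoint (r z))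
      -- The empty simplex involves no wall and makes all moduli 1, so any point of the polytope
      -- serves.
      point (no empty)        _               = p₀ , p₀∈P , λ i → inj₂ (proj₂ (h i) (λ i∈α → empty (i , i∈α)))
      point (yes nonempty)    (inj₁ empty)    = contradiction nonempty empty
      point (yes (k , k∈α)) (inj₂ (y , y∈)) = y , proj₁ (y∈ k∈α) , wall
        where
        wall : ∀ i → ℓ y i ≈ 0# ⊎ r z i ≈ 1#
        wall i with lookup α i in eq
        ... | inside  = inj₁ (proj₂ (y∈ (lookup⇒[]= i α eq)))
        ... | outside = inj₂ (outside⇒1 i eq)

    module _ (z : Vector ℂ m) where

      lift-ZK : (t : Vector ℝ m) → CubicalCone t → (∀ i → r z i ≈ 0# → t i ≈ 0#) → Point ZK
      lift-ZK t (0≤t≤1 , y , y∈P , h) t≈0 =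
        -- The simplex consists of all walls through `y`; off it, the common-point property leaves
        -- only `t i ≈ 1#`.
        (λ i → rescale (z i) (t i)) , proj₁ (zeros y) , inj₂ (y , λ i∈ → y∈P , proj₁ (proj₂ (zeros y) _) ([]=⇒lookup i∈)) ,
        λ i → (λ _ → ≤-respˡ-≈ (sym (∣w∣²≈t i)) (proj₂ (0≤t≤1 i))) ,
              (λ i∉ → trans (∣w∣²≈t i) (t≈1 i i∉))
        where
        ∣w∣²≈t : ∀ i → ∣ rescale (z i) (t i) ∣² ≈ t i
        ∣w∣²≈t i = ∣rescale∣² (z i) (proj₁ (0≤t≤1 i)) (t≈0 i)
        t≈1 : ∀ i → i ∉ proj₁ (zeros y) → t i ≈ 1#
        t≈1 i i∉ with h i | lookup (proj₁ (zeros y)) i in eq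
        ... | inj₂ t≈1 | _       = t≈1
        ... | inj₁ _   | inside  = contradiction (lookup⇒[]= i _ eq) i∉
        ... | inj₁ ℓ≈0 | outside = contradiction ℓ≈0 (proj₂ (proj₂ (zeros y) i) eq)

      lift-ZP : (x : Vector ℝ n) → P x → (∀ i → r z i ≈ 0# → ℓ x i ≈ 0#) → Point ZP
      lift-ZP x x∈P ℓ≈0 = ((x , x∈P) , λ i → rescale (z i) (ℓ x i)) ,
        λ i → sym (∣rescale∣² (z i) (x∈P i) (ℓ≈0 i))

    module _ (X : MetricSpace) (x₀ : Point X) where
      open Pointwise X x₀

      module _ (z : Point X → Vector ℂ m) (cz : ContinuousTo (complexLine ^ m) z) where

        continuous-re : ∀ i → Continuous (λ x → proj₁ (z x i))
        continuous-re i ε 0<ε = near-map (λ _ → ≤-trans (≤-trans (x≤x⊔y _ _) (u≤max _ i))) (cz ε 0<ε)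

        continuous-im : ∀ i → Continuous (λ x → proj₂ (z x i))
        continuous-im i ε 0<ε = near-map (λ _ → ≤-trans (≤-trans (x≤y⊔x _ _) (u≤max _ i))) (cz ε 0<ε)

        continuous-r : ∀ i → Continuous (λ x → r (z x) i)
        continuous-r i = continuous-∣∣² X x₀ (continuous-re i) (continuous-im i)

        continuous-rescaleᵛ : (t : Point X → Vector ℝ m) → (∀ x i → 0# ≤ t x i) →
                              (∀ x i → r (z x) i ≈ 0# → t x i ≈ 0#) → (∀ i → Continuous (λ x → t x i)) →
                              ContinuousTo (complexLine ^ m) (λ x i → rescale (z x i) (t x i))
        continuous-rescaleᵛ t 0≤t t≈0 ct = continuous-into-^ {Y = complexLine} λ i →
          continuous-rescale X x₀ (λ x → 0≤t x i) (λ x → t≈0 x i)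
            (continuous-r i) (ct i) (continuous-re i) (continuous-im i)

        -- Distances in `ZK` ignore the simplex and its witness, so the common point in `t∈` need
        -- not vary continuously.
        continuous-lift-ZK : (t : Point X → Vector ℝ m) (t∈ : ∀ x → CubicalCone (t x))
                             (t≈0 : ∀ x i → r (z x) i ≈ 0# → t x i ≈ 0#) →
                             (∀ i → Continuous (λ x → t x i)) →
                             ContinuousTo ZK (λ x → lift-ZK (z x) (t x) (t∈ x) (t≈0 x))
        continuous-lift-ZK t t∈ = continuous-rescaleᵛ t (λ x i → proj₁ (proj₁ (t∈ x) i))

        continuous-lift-ZP : (u : Point X → Vector ℝ n) (u∈P : ∀ x → P (u x))
                             (ℓ≈0 : ∀ x i → r (z x) i ≈ 0# → ℓ (u x) i ≈ 0#) →
                             (∀ k → Continuous (λ x → u x k)) →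
                             ContinuousTo ZP (λ x → lift-ZP (z x) (u x) (u∈P x) (ℓ≈0 x))
        continuous-lift-ZP u u∈P ℓ≈0 cu = continuous-into-⊗ {line ^ n} {complexLine ^ m}
          (continuous-into-^ {Y = line} cu)
          (continuous-rescaleᵛ (λ x → ℓ (u x)) u∈P ℓ≈0 (continuous-slack X x₀ a b cu))

    ψr : Point ZK → Vector ℝ n
    ψr z = ψ (r (proj₁ z))

    ψr∈P : ∀ z → P (ψr z)
    ψr∈P z = ψ∈P (proj₁ (cone z))

    ψr-wall : ∀ z i → r (proj₁ z) i ≈ 0# → ℓ (ψr z) i ≈ 0#
    ψr-wall z i = ψ-wall (proj₁ (cone z)) (proj₂ (proj₂ (cone z)))

    ZK→ZP : Point ZK → Point ZP
    ZK→ZP z = lift-ZP (proj₁ z) (ψr z) (ψr∈P z) (ψr-wall z)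

    module _ (w : Point ZP) where

      base : Vector ℝ n
      base = proj₁ (proj₁ (proj₁ w))

      base∈P : P base
      base∈P = proj₂ (proj₁ (proj₁ w))

      fibre : Vector ℂ m
      fibre = proj₂ (proj₁ w)

      ℓ≈r : ∀ i → ℓ base i ≈ r fibre i
      ℓ≈r = proj₂ w

      φ-fibre : ∀ i → r fibre i ≈ 0# → φ base i ≈ 0#
      φ-fibre i r≈0 = φ-wall base∈P (trans (ℓ≈r i) r≈0)

      ZP→ZK : Point ZK
      ZP→ZK = lift-ZK fibre (φ base) (φ∈CubicalCone base∈P) φ-fibre

    module _ (X : MetricSpace) (x₀ : Point X) where
      open Pointwise X x₀

      continuous-ψr : (z : Point X → Point ZK) → ContinuousTo ZK z →
                      ∀ k → Continuous (λ x → ψr (z x) k)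
      continuous-ψr z cz k =
        continuous-interpolate X x₀ vertex k (continuous-r X x₀ (λ x → proj₁ (z x)) cz)

      continuous-ZK→ZP : (z : Point X → Point ZK) → ContinuousTo ZK z →
                         ContinuousTo ZP (λ x → ZK→ZP (z x))
      continuous-ZK→ZP z cz = continuous-lift-ZP X x₀ (λ x → proj₁ (z x)) cz
        (λ x → ψr (z x)) (λ x → ψr∈P (z x)) (λ x → ψr-wall (z x)) (continuous-ψr z cz)

      module _ (w : Point X → Point ZP) (cw : ContinuousTo ZP w) where

        continuous-base : ∀ k → Continuous (λ x → base (w x) k)
        continuous-base k ε 0<ε = near-map (λ _ → ≤-trans (≤-trans (u≤max _ k) (x≤x⊔y _ _))) (cw ε 0<ε)

        continuous-fibre : ContinuousTo (complexLine ^ m) (λ x → fibre (w x))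
        continuous-fibre ε 0<ε = near-map (λ _ → ≤-trans (x≤y⊔x _ _)) (cw ε 0<ε)

        continuous-ZP→ZK : ContinuousTo ZK (λ x → ZP→ZK (w x))
        continuous-ZP→ZK = continuous-lift-ZK X x₀ (λ x → fibre (w x)) continuous-fibre
          (λ x → φ (base (w x))) (λ x → φ∈CubicalCone (base∈P (w x))) (λ x → φ-fibre (w x))
          (continuous-φ X x₀ (λ x → base∈P (w x)) continuous-base)

    -- Straight-line homotopies to the identities.

    -- A common point y for ∣z∣² is common to the whole segment, since off the walls
    -- through y both of its ends have coordinate 1.
    module _ (z : Point ZK) where

      segment : ℝ → Vector ℝ m
      segment s = lerpᵛ s (φ (ψr z)) (r (proj₁ z))

      segment-zero : ∀ s i → r (proj₁ z) i ≈ 0# → segment s i ≈ 0#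
      segment-zero s i r≈0 = lerp-const s (φ-wall (ψr∈P z) (ψr-wall z i r≈0)) r≈0

      segment∈CubicalCone : ∀ s → 0# ≤ s × s ≤ 1# → CubicalCone (segment s)
      segment∈CubicalCone s (0≤s , s≤1) = (λ i →
          lerp-≥ 0≤s s≤1 (proj₁ (0≤φ≤1 (ψr∈P z) i)) (proj₁ (proj₁ (cone z) i)) ,
          lerp-≤ 0≤s s≤1 (proj₂ (0≤φ≤1 (ψr∈P z) i)) (proj₂ (proj₁ (cone z) i))) ,
        y , proj₁ y∈ , wall-or-1
        where
        y : Vector ℝ n
        y = proj₁ (proj₂ (cone z))
        y∈ : CommonPoint (r (proj₁ z)) y
        y∈ = proj₂ (proj₂ (cone z))
        wall-or-1 : ∀ i → ℓ y i ≈ 0# ⊎ segment s i ≈ 1#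
        wall-or-1 i with em {ℓ y i ≈ 0#} | proj₂ y∈ i
        ... | yes ℓ≈0 | _        = inj₁ ℓ≈0
        ... | no ℓ≉0  | inj₁ ℓ≈0 = contradiction ℓ≈0 ℓ≉0
        ... | no ℓ≉0  | inj₂ r≈1 = inj₂ (lerp-const s
          (φ-far (ψr∈P z) (≤-trans (threshold≤η (ℓ (ψr z))) (ψ-gap (proj₁ (cone z)) y∈ ℓ≉0))) r≈1)

    module _ (w : Point ZP) where

      path : ℝ → Vector ℝ n
      path s = lerpᵛ s (ψr (ZP→ZK w)) (base w)

      path∈P : ∀ s → 0# ≤ s × s ≤ 1# → P (path s)
      path∈P s (0≤s , s≤1) = P-lerp 0≤s s≤1 (ψr∈P (ZP→ZK w)) (base∈P w)

      -- The squared moduli of `ZP→ZK w` equal `φ (base w)` only up to `≈`, so the hypothesis is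
      -- transported first.
      ψφ-wall : ∀ i → φ (base w) i ≈ 0# → ℓ (ψr (ZP→ZK w)) i ≈ 0#
      ψφ-wall i φ≈0 = ψr-wall (ZP→ZK w) i (trans
        (∣rescale∣² (fibre w i) (proj₁ (0≤φ≤1 (base∈P w) i)) (φ-fibre w i)) φ≈0)

      path-wall : ∀ s i → r (fibre w) i ≈ 0# → ℓ (path s) i ≈ 0#
      path-wall s i r≈0 = trans (ℓ-lerp s _ (base w) i)
        (lerp-const s (ψφ-wall i (φ-fibre w i r≈0)) (trans (ℓ≈r w i) r≈0))

    module _ (Y : MetricSpace) (x₀ : Point (Y ⊗ unitInterval)) where
      open Pointwise (Y ⊗ unitInterval) x₀

      continuous-proj₁ : ContinuousTo Y proj₁
      continuous-proj₁ = nonexpansive⇒continuous {Y} λ _ → x≤x⊔y _ _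

      continuous-time : Continuous (λ x → proj₁ (proj₂ x))
      continuous-time = nonexpansive⇒continuous {line} λ _ → x≤y⊔x _ _

    equivalence : ZK ≃ ZP
    equivalence = record
      { f   = continuousMap ZK→ZP λ z₀ → continuous-ZK→ZP ZK z₀ (λ z → z) (id-continuous ZK z₀)
      ; g   = continuousMap ZP→ZK λ w₀ → continuous-ZP→ZK ZP w₀ (λ w → w) (id-continuous ZP w₀)
      ; g∘f = record
        { homotopy = continuousMap
            (λ (z , s , s∈I) → lift-ZK (proj₁ z) (segment z s) (segment∈CubicalCone z s s∈I) (segment-zero z s))
            λ x₀ → let X = ZK ⊗ unitInterval ; cz = continuous-proj₁ ZK x₀ in
              continuous-lift-ZK X x₀ (λ x → proj₁ (proj₁ x)) cz _
                (λ (z , s , s∈I) → segment∈CubicalCone z s s∈I) (λ (z , s , _) → segment-zero z s)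
                (λ i → continuous-lerp X x₀ (continuous-time ZK x₀)
                  (continuous-φ X x₀ (λ x → ψr∈P (proj₁ x)) (continuous-ψr X x₀ proj₁ cz) i)
                  (continuous-r X x₀ (λ x → proj₁ (proj₁ x)) cz i))
        -- The composite rescales twice, to the slacks of `ψr z` and then to `φ (ψr z)`; the
        -- homotopy rescales once, to the final value.
        ; at-start = λ z i → rescale-rescale (proj₁ z i) (ψr∈P z i) (proj₁ (0≤φ≤1 (ψr∈P z) i))
            (ψr-wall z i) (φ-wall (ψr∈P z)) (lerp-≈0 _ _ refl)
        ; at-end   = λ z i → rescale-∣z∣² (proj₁ z i) (lerp-≈1 _ _ refl)
        }
      ; f∘g = record
        { homotopy = continuousMap
            (λ (w , s , s∈I) → lift-ZP (fibre w) (path w s) (path∈P w s s∈I) (path-wall w s))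
            λ x₀ → let X = ZP ⊗ unitInterval ; cw = continuous-proj₁ ZP x₀ in
              continuous-lift-ZP X x₀ (λ x → fibre (proj₁ x)) (continuous-fibre X x₀ proj₁ cw) _
                (λ (w , s , s∈I) → path∈P w s s∈I) (λ (w , s , _) → path-wall w s)
                (λ k → continuous-lerp X x₀ (continuous-time ZP x₀)
                  (continuous-ψr X x₀ (λ x → ZP→ZK (proj₁ x)) (continuous-ZP→ZK X x₀ proj₁ cw) k)
                  (continuous-base X x₀ proj₁ cw k))
        -- The fibre coordinates are scaled by the slacks of `path w 0#`, which agree with those of
        -- `ψr (ZP→ZK w)` by `ℓ-cong`.
        ; at-start = λ w → (λ k → lerp-≈0 _ _ refl) , λ i →
            rescale-rescale (fibre w i) (proj₁ (0≤φ≤1 (base∈P w) i)) (ψr∈P (ZP→ZK w) i)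
              (φ-fibre w i) (ψφ-wall w i) (ℓ-cong {path w 0#} (λ k → lerp-≈0 _ _ refl) i)
        ; at-end   = λ w → (λ k → lerp-≈1 _ _ refl) , λ i →
            rescale-∣z∣² (fibre w i) (trans (ℓ-cong {path w 1#} (λ k → lerp-≈1 _ _ refl) i) (ℓ≈r w i))
        }
      }
      where
      id-continuous : ∀ X x₀ → Pointwise.ContinuousTo X x₀ X (λ x → x)
      id-continuous X x₀ = Pointwise.nonexpansive⇒continuous X x₀ {X} λ _ → ≤-refl

theorem2 : ExcludedMiddle 0ℓ → (𝐑 : CompleteOrderedField) → let open OverReals 𝐑 in
    (n m : ℕ) (P : Polytope n m) → momentAngleComplex (K P) ≃ momentAngleSpace P
theorem2 em 𝐑 n m P = Equivalence.equivalence em 𝐑 P
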